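{- Let $C$ be a binary singly even self-dual $[130,65,22]$ code whose shadow $S$ has minimum weight at least $5$, with weight enumerators of $C$ and $S$ of the form $$\begin{aligned}W_C=&\,1+(388700 + 2 e)y^{22}+(4791150 + 128 d - 2 e)y^{24}+(81082890 + 8192 c - 896 d - 42 e)y^{26}\\&+(1200197180 + 524288 b - 106496 c + 512 d + 42 e)y^{28}\\&+(14196225992 - 33554432 a - 9961472 b + 532480 c + 10752 d + 420 e) y^{30}+ \cdots,\end{aligned}$$ $$\begin{aligned}W_S=&\,a y^5+(- 30 a + b )y^9+(435 a - 28 b - c )y^{13}+(- 4060 a + 378 b + 26 c + d )y^{17}\\&+(27405 a - 3276 b - 325 c - 24 d - e )y^{21}+ \cdots,\end{aligned}$$ where $a,b,c,d,e$ are integers and the dots denote terms of higher degree. Then $e$ is an even integer.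
   Context: All codes are binary: a code of length $n$ is a subspace of $\mathbb{F}_2^n$, and $[n,k,d]$ denotes length $n$, dimension $k$, minimum weight $d$. A code $C$ is self-dual if $C=C^\perp$ with respect to the standard inner product. A self-dual code is singly even if it contains a codeword of weight $\equiv 2 \pmod 4$. For a singly even self-dual code $C$, let $C_0$ be the subcode of codewords of weight $\equiv 0 \pmod 4$; the shadow of $C$ is $S=C_0^\perp\setminus C$. The weight enumerators are $W_C=\sum_i A_i y^i$ and $W_S=\sum_i B_i y^i$, where $A_i$ and $B_i$ are the numbers of vectors of weight $i$ in $C$ and $S$, respectively. Every singly even self-dual $[130,65,22]$ code with shadow of minimum weight at least $5$ has weight enumerators of the displayed form for some integers $a,b,c,d,e$. -}

module Defs where

open import Level using (0ℓ)
open import Data.Bool.Base using (if_then_else_)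
open import Data.Integer.Base as ℤ using (ℤ; 0ℤ)
open import Data.List.Base using (List; []; _∷_; length)
open import Data.List.Membership.Propositional using () renaming (_∈_ to _∈ᴸ_)
open import Data.List.Relation.Unary.Unique.Propositional using (Unique)
open import Data.Nat.Base using (ℕ; _≤_; _<_; _%_; _≡ᵇ_)
open import Data.Parity.Base as ℙ using (Parity; 0ℙ)
open import Data.Parity.Properties as ℙ using (_≟_)
open import Data.Product.Base using (Σ-syntax; ∃-syntax; _×_; _,_)
open import Data.Vec.Base using (Vec; count; foldr′; map; replicate; zipWith)
open import Data.Vec.Relation.Unary.All using (All)
open import Function.Bundles using (_⇔_)
open import Relation.Binary.PropositionalEquality.Core using (_≡_; _≢_)
open import Relation.Nullary.Decidable.Core using (¬?)
open import Relation.Nullary.Negation.Core using (¬_)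
open import Relation.Unary using (Pred)

-- The library's ring of parities is the field with two elements.
𝔽₂ : Set
𝔽₂ = Parity

Word : ℕ → Set
Word n = Vec 𝔽₂ n

infixl 6 _⊕_
infixl 7 _⊙_

_⊕_ : ∀ {n} → Word n → Word n → Word n
_⊕_ = zipWith ℙ._+_

_⊙_ : ∀ {n} → 𝔽₂ → Word n → Word n
x ⊙ v = map (x ℙ.*_) v

𝟎 : ∀ {n} → Word n
𝟎 = replicate _ 0ℙ

⟨_,_⟩ : ∀ {n} → Word n → Word n → 𝔽₂
⟨ u , v ⟩ = foldr′ ℙ._+_ 0ℙ (zipWith ℙ._*_ u v)

wt : ∀ {n} → Word n → ℕ
wt v = count (λ x → ¬? (x ≟ 0ℙ)) v

record Code (n : ℕ) : Set₁ where
  field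
    Codeword : Pred (Word n) 0ℓ
    𝟎-closed : Codeword 𝟎
    ⊕-closed : ∀ {u v} → Codeword u → Codeword v → Codeword (u ⊕ v)
    ⊙-closed : ∀ x {v} → Codeword v → Codeword (x ⊙ v)

open Code public using (Codeword)

linearCombination : ∀ {n k} → Vec 𝔽₂ k → Vec (Word n) k → Word n
linearCombination xs vs = foldr′ _⊕_ 𝟎 (zipWith _⊙_ xs vs)

record IsBasis {n k : ℕ} (C : Code n) (vs : Vec (Word n) k) : Set where
  field
    codewords   : All (Codeword C) vs
    independent : ∀ xs → linearCombination xs vs ≡ 𝟎 → xs ≡ 𝟎
    spanning    : ∀ v → Codeword C v → ∃[ xs ] linearCombination xs vs ≡ v

HasDimension : ∀ {n} → Code n → ℕ → Set
HasDimension {n} C k = Σ[ vs ∈ Vec (Word n) k ] IsBasis C vs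

-- The minimum runs over nonzero codewords and is attained.
HasMinimumWeight : ∀ {n} → Code n → ℕ → Set
HasMinimumWeight C d =
  (∃[ v ] Codeword C v × v ≢ 𝟎 × wt v ≡ d) ×
  (∀ v → Codeword C v → v ≢ 𝟎 → d ≤ wt v)

Is[_,_,_] : ∀ n → ℕ → ℕ → Code n → Set
Is[ n , k , d ] C = HasDimension C k × HasMinimumWeight C d

infix 10 _^⊥

_^⊥ : ∀ {n} → Pred (Word n) 0ℓ → Pred (Word n) 0ℓ
(P ^⊥) v = ∀ w → P w → ⟨ v , w ⟩ ≡ 0ℙ

SelfDual : ∀ {n} → Code n → Set
SelfDual C = ∀ v → Codeword C v ⇔ (Codeword C ^⊥) v

SinglyEven : ∀ {n} → Code n → Set
SinglyEven C = ∃[ v ] Codeword C v × wt v % 4 ≡ 2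

DoublyEvenPart : ∀ {n} → Code n → Pred (Word n) 0ℓ
DoublyEvenPart C v = Codeword C v × wt v % 4 ≡ 0

Shadow : ∀ {n} → Code n → Pred (Word n) 0ℓ
Shadow C v = (DoublyEvenPart C ^⊥) v × ¬ Codeword C v

MinimumWeightAtLeast : ∀ {n} → Pred (Word n) 0ℓ → ℕ → Set
MinimumWeightAtLeast P d = ∀ v → P v → d ≤ wt v

HasCardinality : ∀ {A : Set} → Pred A 0ℓ → ℕ → Set
HasCardinality {A} P m =
  Σ[ xs ∈ List A ] Unique xs × (∀ x → x ∈ᴸ xs ⇔ P x) × length xs ≡ m

-- An enumerator Σᵢ W i yⁱ is represented by its coefficients W.
IsWeightEnumerator : ∀ {n} → Pred (Word n) 0ℓ → (ℕ → ℕ) → Set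
IsWeightEnumerator P W = ∀ i → HasCardinality (λ v → P v × wt v ≡ i) (W i)

Term : Set
Term = ℤ × ℕ

infix 8 _y^_

_y^_ : ℤ → ℕ → Term
c y^ i = c , i

coefficient : List Term → ℕ → ℤ
coefficient []             i = 0ℤ
coefficient ((c , j) ∷ ts) i =
  (if j ≡ᵇ i then c else 0ℤ) ℤ.+ coefficient ts i

-- Equality modulo y^m; exponents below m absent from the list of terms are
-- thereby asserted to have coefficient zero.
infix 4 _≐_+O[y^_]

_≐_+O[y^_] : (ℕ → ℕ) → List Term → ℕ → Set
W ≐ ts +O[y^ m ] = ∀ i → i < m → ℤ.+ W i ≡ coefficient ts i

{-# OPTIONS --safe #-}

-- Let C₀ be the doubly even part of C, so that its dual is the union of C and S.
-- Apart from 0 and the complements of the words of C of weight 22, the words c of C₀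
-- have weights 24, 28, …, 104, so that X(c) = 130 - 2 wt(c) is a root of the polynomial
-- Q(X) = ∏ (X - (130 - 2w)), w = 24, 28, …, 104.
-- Now c ↦ (-1)^(c₁) Q(X(c)) is the Fourier transform of g = Q(A) δ, where A is the
-- adjacency operator of the hypercube and δ is concentrated on the first unit vector;
-- g is supported on weights at most 22 and g(u) depends on wt u and u₁ only.
-- Summing over C₀, Poisson summation gives a linear relation between the integers
-- a, …, e and the numbers of words of weight 22 in C and of weights 5, 9, 13, 17, 21
-- in S that have a 1 in the first coordinate.  In this relation e has coefficient 1
-- while all the other coefficients are even.
module Submission where

open import Defs
open import Data.Bool.Base using (true; false; T; if_then_else_)
open import Data.Integer.Base using (ℤ; +_; -_; _+_; _-_; _*_; 0ℤ; 1ℤ; -1ℤ)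
open import Data.Integer.Divisibility using (_∣_)
open import Data.Integer.Divisibility.Signed using (divides; ∣⇒∣ᵤ)
import Data.Integer.Properties as ℤₚ
import Data.Integer.Tactic.RingSolver as ℤ-Ring
open import Data.List.Base
  using (List; []; _∷_; _++_; map; foldr; filter; concatMap; drop; applyUpTo; length)
open import Data.List.Membership.Propositional using (_∈_; _∉_)
import Data.List.Membership.DecPropositional as DecMembership
open import Data.List.Membership.Propositional.Properties
  using (∈-map⁺; ∈-map⁻; ∈-++⁺ˡ; ∈-++⁺ʳ; ∈-++⁻; ∈-filter⁺; ∈-filter⁻; ∈-concat⁺′; ∈-concat⁻′; ∈-applyUpTo⁺)
open import Data.List.Membership.Propositional.Properties.WithK using (unique∧set⇒bag)
import Data.List.Properties as Listₚ
open import Data.List.Relation.Binary.BagAndSetEquality using (∼bag⇒↭)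
open import Data.List.Relation.Binary.Disjoint.Propositional using (Disjoint)
open import Data.List.Relation.Binary.Permutation.Propositional as ↭ using (_↭_)
open import Data.List.Relation.Unary.All as All using ([]; _∷_)
import Data.List.Relation.Unary.All.Properties as Allₚ
open import Data.List.Relation.Unary.AllPairs as AllPairs using ([]; _∷_)
import Data.List.Relation.Unary.AllPairs.Properties as AllPairsₚ
open import Data.List.Relation.Unary.Any using (here; there)
open import Data.List.Relation.Unary.Unique.DecPropositional using (unique?)
open import Data.List.Relation.Unary.Unique.Propositional using (Unique)
import Data.List.Relation.Unary.Unique.Propositional.Properties as Unique
open import Data.Nat.Base as ℕ
  using (ℕ; zero; suc; pred; parity; ⌊_/2⌋; _^_; _%_; _!; _<_; _≤_; _≡ᵇ_)
import Data.Nat.DivMod as ℕ-DivMod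
import Data.Nat.Properties as ℕₚ
import Data.Nat.Tactic.RingSolver as ℕ-Ring
open import Data.Parity.Base as ℙ using (Parity; 0ℙ; 1ℙ)
import Data.Parity.Properties as ℙₚ
open import Data.Product.Base using (_×_; _,_; proj₁; proj₂; ∃-syntax)
open import Data.Sum.Base as Sum using (_⊎_; inj₁; inj₂)
open import Data.Vec.Base as Vec using (Vec; []; _∷_; zipWith; replicate)
import Data.Vec.Properties as Vecₚ
open import Data.Vec.Relation.Unary.All using ([]; _∷_) renaming (All to VecAll)
open import Function.Base using (_∘_; const)
open import Function.Bundles using (Equivalence; mk⇔)
open import Level using (0ℓ)
open import Relation.Binary.Definitions using (DecidableEquality)
open import Relation.Binary.PropositionalEquality
  using (_≡_; _≢_; refl; sym; trans; cong; cong₂; subst; module ≡-Reasoning)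
open import Relation.Nullary.Decidable using (Dec; yes; no; from-yes; from-no; toWitness)
open import Relation.Nullary.Negation.Core using (contradiction; ¬_)
open import Relation.Unary using (Pred)
open import Algebra.Properties.CommutativeSemigroup ℙₚ.+-commutativeSemigroup using (interchange)

open ≡-Reasoning

private variable
  A B : Set

-- Finite sums

∑ : List A → (A → ℤ) → ℤ
∑ []       f = 0ℤ
∑ (x ∷ xs) f = f x + ∑ xs f

infix 5 ∑
syntax ∑ xs (λ x → e) = ∑[ x ∈ xs ] e

∑-cong : ∀ (xs : List A) {f g : A → ℤ} → (∀ {x} → x ∈ xs → f x ≡ g x) → ∑ xs f ≡ ∑ xs g
∑-cong []       eq = refl
∑-cong (x ∷ xs) eq = cong₂ _+_ (eq (here refl)) (∑-cong xs (eq ∘ there))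

∑-zero : ∀ (xs : List A) {f : A → ℤ} → (∀ {x} → x ∈ xs → f x ≡ 0ℤ) → ∑ xs f ≡ 0ℤ
∑-zero []       eq = refl
∑-zero (x ∷ xs) eq = cong₂ _+_ (eq (here refl)) (∑-zero xs (eq ∘ there))

∑-++ : ∀ (xs ys : List A) f → ∑ (xs ++ ys) f ≡ ∑ xs f + ∑ ys f
∑-++ []       ys f = sym (ℤₚ.+-identityˡ _)
∑-++ (x ∷ xs) ys f = trans (cong (_+_ (f x)) (∑-++ xs ys f)) (sym (ℤₚ.+-assoc (f x) _ _))

∑-map : ∀ (h : A → B) xs f → ∑ (map h xs) f ≡ ∑ xs (f ∘ h)
∑-map h []       f = refl
∑-map h (x ∷ xs) f = cong (_+_ (f (h x))) (∑-map h xs f)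

∑-concatMap : ∀ (h : A → List B) xs f → ∑ (concatMap h xs) f ≡ ∑[ x ∈ xs ] ∑ (h x) f
∑-concatMap h []       f = refl
∑-concatMap h (x ∷ xs) f = trans (∑-++ (h x) _ f) (cong (_+_ (∑ (h x) f)) (∑-concatMap h xs f))

∑-distrib-+ : ∀ (xs : List A) f g → ∑[ x ∈ xs ] (f x + g x) ≡ ∑ xs f + ∑ xs g
∑-distrib-+ []       f g = refl
∑-distrib-+ (x ∷ xs) f g = begin
  f x + g x + (∑[ y ∈ xs ] (f y + g y)) ≡⟨ cong (_+_ (f x + g x)) (∑-distrib-+ xs f g) ⟩
  f x + g x + (∑ xs f + ∑ xs g)         ≡⟨ exchange (f x) (g x) (∑ xs f) (∑ xs g) ⟩
  f x + ∑ xs f + (g x + ∑ xs g)         ∎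
  where
  exchange : ∀ a b c d → a + b + (c + d) ≡ a + c + (b + d)
  exchange = ℤ-Ring.solve-∀

∑-distribˡ-* : ∀ (xs : List A) k f → ∑[ x ∈ xs ] (k * f x) ≡ k * ∑ xs f
∑-distribˡ-* []       k f = sym (ℤₚ.*-zeroʳ k)
∑-distribˡ-* (x ∷ xs) k f =
  trans (cong (_+_ (k * f x)) (∑-distribˡ-* xs k f)) (sym (ℤₚ.*-distribˡ-+ k (f x) _))

∑-swap : ∀ (xs : List A) (ys : List B) (f : A → B → ℤ) →
         ∑[ x ∈ xs ] ∑[ y ∈ ys ] f x y ≡ ∑[ y ∈ ys ] ∑[ x ∈ xs ] f x y
∑-swap []       ys f = sym (∑-zero ys (λ _ → refl))
∑-swap (x ∷ xs) ys f =
  trans (cong (_+_ (∑ ys (f x))) (∑-swap xs ys f)) (sym (∑-distrib-+ ys (f x) _))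

∑-↭ : ∀ {xs ys : List A} f → xs ↭ ys → ∑ xs f ≡ ∑ ys f
∑-↭ f ↭.refl                 = refl
∑-↭ f (↭.prep x p)           = cong (_+_ (f x)) (∑-↭ f p)
∑-↭ f (↭.swap {xs} {ys} x y p) = begin
  f x + (f y + ∑ xs f) ≡⟨ cong (λ s → f x + (f y + s)) (∑-↭ f p) ⟩
  f x + (f y + ∑ ys f) ≡⟨ exchange (f x) (f y) _ ⟩
  f y + (f x + ∑ ys f) ∎
  where
  exchange : ∀ a b c → a + (b + c) ≡ b + (a + c)
  exchange = ℤ-Ring.solve-∀
∑-↭ f (↭.trans p q)          = trans (∑-↭ f p) (∑-↭ f q)

module _ (_≟_ : DecidableEquality A) where
  open import Data.List.Membership.DecPropositional _≟_ using (_∈?_)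

  ∑-filter-∈ : ∀ xs ys (f : A → ℤ) → (∀ {x} → x ∈ xs → x ∉ ys → f x ≡ 0ℤ) →
               ∑ xs f ≡ ∑ (filter (_∈? ys) xs) f
  ∑-filter-∈ []       ys f f≡0 = refl
  ∑-filter-∈ (x ∷ xs) ys f f≡0 with x ∈? ys
  ... | yes x∈ys = cong (_+_ (f x)) (∑-filter-∈ xs ys f (f≡0 ∘ there))
  ... | no  x∉ys = trans (cong₂ _+_ (f≡0 (here refl) x∉ys) (∑-filter-∈ xs ys f (f≡0 ∘ there)))
                         (ℤₚ.+-identityˡ _)

  -- Filtering `xs` by membership in `ys` drops only zero terms and leaves a duplicate-free list
  -- with the members of `ys`, hence a permutation of it. Sums over all words are cut down to short
  -- lists in this way.
  ∑-support : ∀ {xs ys} (f : A → ℤ) → Unique xs → Unique ys → (∀ {y} → y ∈ ys → y ∈ xs) →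
              (∀ {x} → x ∈ xs → x ∉ ys → f x ≡ 0ℤ) → ∑ xs f ≡ ∑ ys f
  ∑-support {xs} {ys} f xs! ys! ys⊆xs f≡0 =
    trans (∑-filter-∈ xs ys f f≡0)
      (∑-↭ f (∼bag⇒↭ (unique∧set⇒bag (Unique.filter⁺ (_∈? ys) xs!) ys!
        (mk⇔ (proj₂ ∘ ∈-filter⁻ (_∈? ys) {xs = xs})
             (λ y∈ys → ∈-filter⁺ (_∈? ys) {xs = xs} (ys⊆xs y∈ys) y∈ys)))))

-- Words, and the Fourier transform of functions on them

-- Abstract, to keep Agda from enumerating the words of length 65 or 130.
abstract
  words : ∀ n → List (Word n)
  words zero    = [] ∷ []
  words (suc n) = map (0ℙ ∷_) (words n) ++ map (1ℙ ∷_) (words n)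

  ∈-words : ∀ {n} (u : Word n) → u ∈ words n
  ∈-words []        = here refl
  ∈-words (0ℙ ∷ u) = ∈-++⁺ˡ (∈-map⁺ (0ℙ ∷_) (∈-words u))
  ∈-words (1ℙ ∷ u) = ∈-++⁺ʳ (map (0ℙ ∷_) (words _)) (∈-map⁺ (1ℙ ∷_) (∈-words u))

  words-unique : ∀ n → Unique (words n)
  words-unique zero    = [] ∷ []
  words-unique (suc n) =
    Unique.++⁺ (Unique.map⁺ Vecₚ.∷-injectiveʳ (words-unique n))
               (Unique.map⁺ Vecₚ.∷-injectiveʳ (words-unique n))
               disjoint
    where
    disjoint : ∀ {u} → ¬ (u ∈ map (0ℙ ∷_) (words n) × u ∈ map (1ℙ ∷_) (words n))
    disjoint (p , q) with ∈-map⁻ (0ℙ ∷_) p | ∈-map⁻ (1ℙ ∷_) q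
    ... | _ , _ , refl | _ , _ , ()

  ∑-words-zero : ∀ f → ∑ (words 0) f ≡ f []
  ∑-words-zero f = ℤₚ.+-identityʳ (f [])

  ∑-words-suc : ∀ n f → ∑ (words (suc n)) f ≡ (∑[ u ∈ words n ] f (0ℙ ∷ u)) + (∑[ u ∈ words n ] f (1ℙ ∷ u))
  ∑-words-suc n f = trans (∑-++ (map (0ℙ ∷_) (words n)) _ f)
    (cong₂ _+_ (∑-map (0ℙ ∷_) (words n) f) (∑-map (1ℙ ∷_) (words n) f))

sgn : Parity → ℤ
sgn 0ℙ = 1ℤ
sgn 1ℙ = -1ℤ

sgn-+ : ∀ p q → sgn (p ℙ.+ q) ≡ sgn p * sgn q
sgn-+ 0ℙ 0ℙ = refl
sgn-+ 0ℙ 1ℙ = refl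
sgn-+ 1ℙ 0ℙ = refl
sgn-+ 1ℙ 1ℙ = refl

𝓕 : ∀ {n} → (Word n → ℤ) → Word n → ℤ
𝓕 g c = ∑[ u ∈ words _ ] sgn ⟨ u , c ⟩ * g u

𝓕-∷ : ∀ {n} (g : Word (suc n) → ℤ) y c →
      𝓕 g (y ∷ c) ≡ 𝓕 (g ∘ (0ℙ ∷_)) c + sgn y * 𝓕 (g ∘ (1ℙ ∷_)) c
𝓕-∷ {n} g y c = trans (∑-words-suc n _) (cong (_+_ (𝓕 (g ∘ (0ℙ ∷_)) c)) (begin
  ∑[ u ∈ words n ] sgn (y ℙ.+ ⟨ u , c ⟩) * g (1ℙ ∷ u)     ≡⟨ ∑-cong (words n) (λ {u} _ → split u) ⟩
  ∑[ u ∈ words n ] sgn y * (sgn ⟨ u , c ⟩ * g (1ℙ ∷ u))   ≡⟨ ∑-distribˡ-* (words n) (sgn y) _ ⟩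
  sgn y * 𝓕 (g ∘ (1ℙ ∷_)) c                             ∎))
  where
  split : ∀ u → sgn (y ℙ.+ ⟨ u , c ⟩) * g (1ℙ ∷ u) ≡ sgn y * (sgn ⟨ u , c ⟩ * g (1ℙ ∷ u))
  split u = trans (cong (_* g (1ℙ ∷ u)) (sgn-+ y ⟨ u , c ⟩)) (ℤₚ.*-assoc (sgn y) _ _)

𝓕-cong : ∀ {n} {g h : Word n → ℤ} → (∀ u → g u ≡ h u) → ∀ c → 𝓕 g c ≡ 𝓕 h c
𝓕-cong eq c = ∑-cong (words _) (λ {u} _ → cong (sgn ⟨ u , c ⟩ *_) (eq u))

𝓕-linear : ∀ {n} (g h : Word n → ℤ) k c → 𝓕 (λ u → g u + k * h u) c ≡ 𝓕 g c + k * 𝓕 h c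
𝓕-linear {n} g h k c = begin
  ∑[ u ∈ words n ] sgn ⟨ u , c ⟩ * (g u + k * h u)
    ≡⟨ ∑-cong (words n) (λ {u} _ → expand (sgn ⟨ u , c ⟩) (g u) k (h u)) ⟩
  ∑[ u ∈ words n ] (sgn ⟨ u , c ⟩ * g u + k * (sgn ⟨ u , c ⟩ * h u))
    ≡⟨ ∑-distrib-+ (words n) _ _ ⟩
  𝓕 g c + (∑[ u ∈ words n ] k * (sgn ⟨ u , c ⟩ * h u))
    ≡⟨ cong (_+_ (𝓕 g c)) (∑-distribˡ-* (words n) k _) ⟩
  𝓕 g c + k * 𝓕 h c ∎
  where
  expand : ∀ s x k y → s * (x + k * y) ≡ s * x + k * (s * y)
  expand = ℤ-Ring.solve-∀

-- The adjacency operator of the hypercube and its eigenvalues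

adjacency : ∀ {n} → (Word n → ℤ) → Word n → ℤ
adjacency g []      = 0ℤ
adjacency g (x ∷ u) = g (x ℙ.⁻¹ ∷ u) + adjacency (g ∘ (x ∷_)) u

-- The scalar by which the adjacency operator acts on the character of `c`: flipping coordinate i of
-- `u` multiplies `sgn ⟨ u , c ⟩` by the sign of `c` at i.
eigenvalue : ∀ {n} → Word n → ℤ
eigenvalue []      = 0ℤ
eigenvalue (y ∷ c) = sgn y + eigenvalue c

-- Flipping the first coordinate exchanges the halves `g₀` and `g₁`, which under the transform
-- amounts to a factor `sgn y`; the other coordinates give `eigenvalue c` by induction.
𝓕-adjacency : ∀ {n} (g : Word n → ℤ) c → 𝓕 (adjacency g) c ≡ eigenvalue c * 𝓕 g c
𝓕-adjacency g []      = ∑-words-zero _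
𝓕-adjacency g (y ∷ c) = begin
  𝓕 (adjacency g) (y ∷ c)
    ≡⟨ 𝓕-∷ (adjacency g) y c ⟩
  𝓕 (λ u → g₁ u + adjacency g₀ u) c + s * 𝓕 (λ u → g₀ u + adjacency g₁ u) c
    ≡⟨ cong₂ (λ p q → p + s * q) (sum g₁ (adjacency g₀)) (sum g₀ (adjacency g₁)) ⟩
  (𝓕 g₁ c + 𝓕 (adjacency g₀) c) + s * (𝓕 g₀ c + 𝓕 (adjacency g₁) c)
    ≡⟨ cong₂ (λ p q → (𝓕 g₁ c + p) + s * (𝓕 g₀ c + q)) (𝓕-adjacency g₀ c) (𝓕-adjacency g₁ c) ⟩
  (𝓕 g₁ c + e * 𝓕 g₀ c) + s * (𝓕 g₀ c + e * 𝓕 g₁ c)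
    -- Since `s` is a sign, `s * s` is 1; inserting it lets the expression factor.
    ≡⟨ cong (λ k → (k + e * 𝓕 g₀ c) + s * (𝓕 g₀ c + e * 𝓕 g₁ c)) (sgn² y (𝓕 g₁ c)) ⟩
  (s * s * 𝓕 g₁ c + e * 𝓕 g₀ c) + s * (𝓕 g₀ c + e * 𝓕 g₁ c)
    ≡⟨ collect s e (𝓕 g₀ c) (𝓕 g₁ c) ⟩
  (s + e) * (𝓕 g₀ c + s * 𝓕 g₁ c)
    ≡⟨ cong ((s + e) *_) (𝓕-∷ g y c) ⟨
  (s + e) * 𝓕 g (y ∷ c) ∎
  where
  g₀ = g ∘ (0ℙ ∷_)
  g₁ = g ∘ (1ℙ ∷_)
  s = sgn y
  e = eigenvalue c
  sum : ∀ f h → 𝓕 (λ u → f u + h u) c ≡ 𝓕 f c + 𝓕 h c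
  sum f h = begin
    𝓕 (λ u → f u + h u) c      ≡⟨ 𝓕-cong (λ u → cong (_+_ (f u)) (sym (ℤₚ.*-identityˡ (h u)))) c ⟩
    𝓕 (λ u → f u + 1ℤ * h u) c ≡⟨ 𝓕-linear f h 1ℤ c ⟩
    𝓕 f c + 1ℤ * 𝓕 h c       ≡⟨ cong (_+_ (𝓕 f c)) (ℤₚ.*-identityˡ (𝓕 h c)) ⟩
    𝓕 f c + 𝓕 h c            ∎
  sgn² : ∀ p k → k ≡ sgn p * sgn p * k
  sgn² 0ℙ k = sym (ℤₚ.*-identityˡ k)
  sgn² 1ℙ k = sym (ℤₚ.*-identityˡ k)
  collect : ∀ s e a b → (s * s * b + e * a) + s * (a + e * b) ≡ (s + e) * (a + s * b)
  collect = ℤ-Ring.solve-∀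

-- A word of weight w has n - w neighbours of weight w + 1 and w of weight w - 1. At w = 0 the value
-- at `pred w` is multiplied by 0.
adjacency-radial : ∀ {n} (f : ℕ → ℤ) (u : Word n) →
  adjacency (f ∘ wt) u ≡ (+ n - + wt u) * f (suc (wt u)) + + wt u * f (pred (wt u))
adjacency-radial f []       = refl
adjacency-radial {suc n} f (0ℙ ∷ u) = begin
  f (suc w) + adjacency (f ∘ wt) u
    ≡⟨ cong (_+_ (f (suc w))) (adjacency-radial f u) ⟩
  f (suc w) + ((+ n - + w) * f (suc w) + + w * f (pred w))
    ≡⟨ collect (+ n) (+ w) (f (suc w)) (f (pred w)) ⟩
  (1ℤ + + n - + w) * f (suc w) + + w * f (pred w) ∎
  where
  w = wt u
  collect : ∀ n w a b → a + ((n - w) * a + w * b) ≡ (1ℤ + n - w) * a + w * b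
  collect = ℤ-Ring.solve-∀
adjacency-radial {suc n} f (1ℙ ∷ u) = begin
  f w + adjacency (f ∘ suc ∘ wt) u
    ≡⟨ cong (_+_ (f w)) (adjacency-radial (f ∘ suc) u) ⟩
  f w + ((+ n - + w) * f (suc (suc w)) + + w * f (suc (pred w)))
    ≡⟨ cong (λ x → f w + ((+ n - + w) * f (suc (suc w)) + x)) (suc-pred w) ⟩
  f w + ((+ n - + w) * f (suc (suc w)) + + w * f w)
    ≡⟨ collect (+ n) (+ w) (f (suc (suc w))) (f w) ⟩
  (1ℤ + + n - (1ℤ + + w)) * f (suc (suc w)) + (1ℤ + + w) * f w ∎
  where
  w = wt u
  -- `suc (pred w)` differs from `w` only at 0, where the factor `+ w` vanishes.
  suc-pred : ∀ w → + w * f (suc (pred w)) ≡ + w * f w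
  suc-pred zero    = refl
  suc-pred (suc w) = refl
  collect : ∀ n w a b → b + ((n - w) * a + w * b) ≡ (1ℤ + n - (1ℤ + w)) * a + (1ℤ + w) * b
  collect = ℤ-Ring.solve-∀

-- Functions of the weight as finite lists of values

at : List ℤ → ℕ → ℤ
at []       _       = 0ℤ
at (x ∷ xs) zero    = x
at (x ∷ xs) (suc i) = at xs i

at-drop₁ : ∀ xs i → at (drop 1 xs) i ≡ at xs (suc i)
at-drop₁ []       i = refl
at-drop₁ (x ∷ xs) i = refl

at-beyond : ∀ xs {i} → length xs ℕ.≤ i → at xs i ≡ 0ℤ
at-beyond []       _           = refl
at-beyond (x ∷ xs) (ℕ.s≤s n≤i) = at-beyond xs n≤i

infixl 6 _⊞_

_⊞_ : List ℤ → List ℤ → List ℤ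
[]       ⊞ ys       = ys
(x ∷ xs) ⊞ []       = x ∷ xs
(x ∷ xs) ⊞ (y ∷ ys) = x + y ∷ xs ⊞ ys

at-⊞ : ∀ xs ys i → at (xs ⊞ ys) i ≡ at xs i + at ys i
at-⊞ []       ys       i       = sym (ℤₚ.+-identityˡ _)
at-⊞ (x ∷ xs) []       i       = sym (ℤₚ.+-identityʳ _)
at-⊞ (x ∷ xs) (y ∷ ys) zero    = refl
at-⊞ (x ∷ xs) (y ∷ ys) (suc i) = at-⊞ xs ys i

scale : (ℕ → ℤ) → List ℤ → List ℤ
scale f []       = []
scale f (x ∷ xs) = f 0 * x ∷ scale (f ∘ suc) xs

at-scale : ∀ f xs i → at (scale f xs) i ≡ f i * at xs i
at-scale f []       i       = sym (ℤₚ.*-zeroʳ (f i))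
at-scale f (x ∷ xs) zero    = refl
at-scale f (x ∷ xs) (suc i) = at-scale (f ∘ suc) xs i

-- The operator of `adjacency-radial` on lists of values: dropping the head reads the value at w +
-- 1, prepending `0ℤ` the value at w - 1.
neighbours : ℕ → List ℤ → List ℤ
neighbours n t = scale (λ w → + n - + w) (drop 1 t) ⊞ (0ℤ ∷ scale (λ w → + suc w) t)

at-neighbours : ∀ n t w →
  at (neighbours n t) w ≡ (+ n - + w) * at t (suc w) + + w * at t (pred w)
at-neighbours n t w = begin
  at (neighbours n t) w
    ≡⟨ at-⊞ (scale (λ w → + n - + w) (drop 1 t)) _ w ⟩
  at (scale (λ w → + n - + w) (drop 1 t)) w + at (0ℤ ∷ scale (λ w → + suc w) t) w
    ≡⟨ cong₂ _+_ (at-scale (λ w → + n - + w) (drop 1 t) w) (raised w) ⟩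
  (+ n - + w) * at (drop 1 t) w + + w * at t (pred w)
    ≡⟨ cong (λ x → (+ n - + w) * x + + w * at t (pred w)) (at-drop₁ t w) ⟩
  (+ n - + w) * at t (suc w) + + w * at t (pred w) ∎
  where
  raised : ∀ w → at (0ℤ ∷ scale (λ w → + suc w) t) w ≡ + w * at t (pred w)
  raised zero    = refl
  raised (suc w) = at-scale (λ w → + suc w) t w

-- A table (s , t) stands for the function on words whose value at x ∷ u is
-- entry wt u of s or of t, according as x is 0ℙ or 1ℙ.
Table : Set
Table = List ℤ × List ℤ

value : ∀ {n} → Table → Word (suc n) → ℤ
value (s , t) (0ℙ ∷ u) = at s (wt u)
value (s , t) (1ℙ ∷ u) = at t (wt u)

-- The operator A - r on words of length n + 1. Flipping the first coordinate exchanges `s` and `t`;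
-- flips in the n remaining ones act on each list by `neighbours n`.
shift : ℕ → ℤ → Table → Table
shift n r (s , t) = t ⊞ neighbours n s ⊞ scale (const (- r)) s
                  , s ⊞ neighbours n t ⊞ scale (const (- r)) t

value-shift : ∀ {n} r T (u : Word (suc n)) →
  value (shift n r T) u ≡ adjacency (value T) u + - r * value T u
value-shift {n} r (s , t) (x ∷ u) = go x
  where
  component : ∀ s t → at (t ⊞ neighbours n s ⊞ scale (const (- r)) s) (wt u) ≡
                      at t (wt u) + adjacency (at s ∘ wt) u + - r * at s (wt u)
  component s t = begin
    at (t ⊞ neighbours n s ⊞ scale (const (- r)) s) (wt u)
      ≡⟨ at-⊞ (t ⊞ neighbours n s) _ (wt u) ⟩
    at (t ⊞ neighbours n s) (wt u) + at (scale (const (- r)) s) (wt u)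
      ≡⟨ cong₂ _+_ (at-⊞ t (neighbours n s) (wt u)) (at-scale (const (- r)) s (wt u)) ⟩
    at t (wt u) + at (neighbours n s) (wt u) + - r * at s (wt u)
      ≡⟨ cong (λ x → at t (wt u) + x + - r * at s (wt u))
           (trans (at-neighbours n s (wt u)) (sym (adjacency-radial (at s) u))) ⟩
    at t (wt u) + adjacency (at s ∘ wt) u + - r * at s (wt u) ∎
  go : ∀ x → value (shift n r (s , t)) (x ∷ u) ≡
             adjacency (value (s , t)) (x ∷ u) + - r * value (s , t) (x ∷ u)
  go 0ℙ = component s t
  go 1ℙ = component t s

-- The table `([] , 1ℤ ∷ [])` is the indicator of the first unit vector, so a single term of the
-- transform survives.
𝓕-value-point : ∀ {n} (c : Word (suc n)) → 𝓕 (value ([] , 1ℤ ∷ [])) c ≡ sgn (Vec.head c)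
𝓕-value-point (y ∷ c) = begin
  𝓕 (value ([] , 1ℤ ∷ [])) (y ∷ c)
    ≡⟨ 𝓕-∷ (value ([] , 1ℤ ∷ [])) y c ⟩
  𝓕 (λ _ → 0ℤ) c + sgn y * 𝓕 (at (1ℤ ∷ []) ∘ wt) c
    ≡⟨ cong₂ (λ p q → p + sgn y * q) (𝓕-zero c) (𝓕-origin c) ⟩
  0ℤ + sgn y * 1ℤ
    ≡⟨ trans (ℤₚ.+-identityˡ _) (ℤₚ.*-identityʳ (sgn y)) ⟩
  sgn y ∎
  where
  𝓕-zero : ∀ {n} (c : Word n) → 𝓕 (λ _ → 0ℤ) c ≡ 0ℤ
  𝓕-zero c = ∑-zero (words _) (λ {u} _ → ℤₚ.*-zeroʳ (sgn ⟨ u , c ⟩))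
  𝓕-origin : ∀ {n} (c : Word n) → 𝓕 (at (1ℤ ∷ []) ∘ wt) c ≡ 1ℤ
  𝓕-origin []      = ∑-words-zero _
  𝓕-origin (y ∷ c) = begin
    𝓕 (at (1ℤ ∷ []) ∘ wt) (y ∷ c)
      ≡⟨ 𝓕-∷ (at (1ℤ ∷ []) ∘ wt) y c ⟩
    𝓕 (at (1ℤ ∷ []) ∘ wt) c + sgn y * 𝓕 (λ _ → 0ℤ) c
      ≡⟨ cong₂ (λ p q → p + sgn y * q) (𝓕-origin c) (𝓕-zero c) ⟩
    1ℤ + sgn y * 0ℤ
      ≡⟨ cong (_+_ 1ℤ) (ℤₚ.*-zeroʳ (sgn y)) ⟩
    1ℤ ∎

-- The product of the operators A - r over the listed r, applied to the indicator of the first unit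
-- vector.
table : ℕ → List ℤ → Table
table n = foldr (shift n) ([] , 1ℤ ∷ [])

∏⟨_-_⟩ : ℤ → List ℤ → ℤ
∏⟨ x - rs ⟩ = foldr (λ r p → (x - r) * p) 1ℤ rs

∏-root : ∀ {x rs} → x ∈ rs → ∏⟨ x - rs ⟩ ≡ 0ℤ
∏-root {x} {rs = r ∷ rs} (here refl) = cong (_* ∏⟨ x - rs ⟩) (ℤₚ.+-inverseʳ r)
∏-root {x} {rs = r ∷ rs} (there x∈)  = trans (cong ((x - r) *_) (∏-root x∈)) (ℤₚ.*-zeroʳ (x - r))

-- Each factor A - r multiplies the transform by `eigenvalue c - r`.
𝓕-value-foldr : ∀ {n} rs (c : Word (suc n)) →
  𝓕 (value (table n rs)) c ≡ ∏⟨ eigenvalue c - rs ⟩ * sgn (Vec.head c)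
𝓕-value-foldr {n} []       c = trans (𝓕-value-point c) (sym (ℤₚ.*-identityˡ _))
𝓕-value-foldr {n} (r ∷ rs) c = begin
  𝓕 (value (table n (r ∷ rs))) c
    ≡⟨ 𝓕-cong (value-shift r (table n rs)) c ⟩
  𝓕 (λ u → adjacency g u + - r * g u) c
    ≡⟨ 𝓕-linear (adjacency g) g (- r) c ⟩
  𝓕 (adjacency g) c + - r * 𝓕 g c
    ≡⟨ cong (λ x → x + - r * 𝓕 g c) (𝓕-adjacency g c) ⟩
  e * 𝓕 g c + - r * 𝓕 g c
    ≡⟨ ℤₚ.*-distribʳ-+ (𝓕 g c) e (- r) ⟨
  (e - r) * 𝓕 g c
    ≡⟨ cong ((e - r) *_) (𝓕-value-foldr rs c) ⟩
  (e - r) * (∏⟨ e - rs ⟩ * sgn (Vec.head c))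
    ≡⟨ ℤₚ.*-assoc (e - r) _ _ ⟨
  ∏⟨ e - r ∷ rs ⟩ * sgn (Vec.head c) ∎
  where
  g = value (table n rs)
  e = eigenvalue c

-- `T` and `Q` enter through equations only, so that opaque constants can stand for the computed
-- table and the product.
𝓕-value-table : ∀ {n rs T} {Q : ℤ → ℤ} → table n rs ≡ T → (∀ x → Q x ≡ ∏⟨ x - rs ⟩) →
  ∀ (c : Word (suc n)) → 𝓕 (value T) c ≡ Q (eigenvalue c) * sgn (Vec.head c)
𝓕-value-table {rs = rs} refl Q≡ c =
  trans (𝓕-value-foldr rs c) (cong (_* sgn (Vec.head c)) (sym (Q≡ (eigenvalue c))))

eigenvalue-wt : ∀ {n} (c : Word n) → eigenvalue c ≡ + n - + 2 * + wt c
eigenvalue-wt []       = refl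
eigenvalue-wt {suc n} (0ℙ ∷ c) = trans (cong (_+_ 1ℤ) (eigenvalue-wt c)) (reassoc (+ n) (+ wt c))
  where
  reassoc : ∀ n w → 1ℤ + (n - + 2 * w) ≡ 1ℤ + n - + 2 * w
  reassoc = ℤ-Ring.solve-∀
eigenvalue-wt {suc n} (1ℙ ∷ c) = trans (cong (_+_ -1ℤ) (eigenvalue-wt c)) (reassoc (+ n) (+ wt c))
  where
  reassoc : ∀ n w → -1ℤ + (n - + 2 * w) ≡ 1ℤ + n - + 2 * (1ℤ + w)
  reassoc = ℤ-Ring.solve-∀

-- Linear combinations, characters and the shadow

𝟏 : ∀ {n} → Word n
𝟏 = replicate _ 1ℙ

⊕-identityˡ : ∀ {n} (u : Word n) → 𝟎 ⊕ u ≡ u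
⊕-identityˡ = Vecₚ.zipWith-identityˡ ℙₚ.+-identityˡ

⊕-self : ∀ {n} (u : Word n) → u ⊕ u ≡ 𝟎
⊕-self []      = refl
⊕-self (x ∷ u) = cong₂ _∷_ (ℙₚ.p+p≡0ℙ x) (⊕-self u)

⊕-cancel : ∀ {n} (u v : Word n) → u ⊕ (u ⊕ v) ≡ v
⊕-cancel u v = begin
  u ⊕ (u ⊕ v) ≡⟨ Vecₚ.zipWith-assoc ℙₚ.+-assoc u u v ⟨
  u ⊕ u ⊕ v   ≡⟨ cong (_⊕ v) (⊕-self u) ⟩
  𝟎 ⊕ v       ≡⟨ ⊕-identityˡ v ⟩
  v           ∎

0ℙ⊙ : ∀ {n} (u : Word n) → 0ℙ ⊙ u ≡ 𝟎
0ℙ⊙ u = Vecₚ.map-const u 0ℙ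

1ℙ⊙ : ∀ {n} (u : Word n) → 1ℙ ⊙ u ≡ u
1ℙ⊙ = Vecₚ.map-id

-- Inner products and weights modulo 4

⟨,⟩-comm : ∀ {n} (u v : Word n) → ⟨ u , v ⟩ ≡ ⟨ v , u ⟩
⟨,⟩-comm []      []      = refl
⟨,⟩-comm (x ∷ u) (y ∷ v) = cong₂ ℙ._+_ (ℙₚ.*-comm x y) (⟨,⟩-comm u v)

⟨,⟩-⊕ : ∀ {n} (u v w : Word n) → ⟨ u , v ⊕ w ⟩ ≡ ⟨ u , v ⟩ ℙ.+ ⟨ u , w ⟩
⟨,⟩-⊕ []      []      []      = refl
⟨,⟩-⊕ (x ∷ u) (y ∷ v) (z ∷ w) =
  trans (cong₂ ℙ._+_ (ℙₚ.*-distribˡ-+ x y z) (⟨,⟩-⊕ u v w))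
        (interchange (x ℙ.* y) (x ℙ.* z) ⟨ u , v ⟩ ⟨ u , w ⟩)

⟨,⟩-self : ∀ {n} (u : Word n) → ⟨ u , u ⟩ ≡ parity (wt u)
⟨,⟩-self []       = refl
⟨,⟩-self (0ℙ ∷ u) = ⟨,⟩-self u
⟨,⟩-self (1ℙ ∷ u) = trans (cong (1ℙ ℙ.+_) (⟨,⟩-self u)) (sym (ℙₚ.+-homo-+ 1 (wt u)))

⟨,𝟏⟩ : ∀ {n} (u : Word n) → ⟨ u , 𝟏 ⟩ ≡ parity (wt u)
⟨,𝟏⟩ []       = refl
⟨,𝟏⟩ (0ℙ ∷ u) = ⟨,𝟏⟩ u
⟨,𝟏⟩ (1ℙ ∷ u) = trans (cong (1ℙ ℙ.+_) (⟨,𝟏⟩ u)) (sym (ℙₚ.+-homo-+ 1 (wt u)))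

commonOnes : ∀ {n} → Word n → Word n → ℕ
commonOnes u v = wt (zipWith ℙ._*_ u v)

parity-commonOnes : ∀ {n} (u v : Word n) → parity (commonOnes u v) ≡ ⟨ u , v ⟩
parity-commonOnes []       []       = refl
parity-commonOnes (0ℙ ∷ u) (y ∷ v)  = parity-commonOnes u v
parity-commonOnes (1ℙ ∷ u) (0ℙ ∷ v) = parity-commonOnes u v
parity-commonOnes (1ℙ ∷ u) (1ℙ ∷ v) =
  trans (ℙₚ.+-homo-+ 1 (commonOnes u v)) (cong (1ℙ ℙ.+_) (parity-commonOnes u v))

wt-⊕ : ∀ {n} (u v : Word n) → wt (u ⊕ v) ℕ.+ 2 ℕ.* commonOnes u v ≡ wt u ℕ.+ wt v
wt-⊕ []       []       = refl
wt-⊕ (0ℙ ∷ u) (0ℙ ∷ v) = wt-⊕ u v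
wt-⊕ (0ℙ ∷ u) (1ℙ ∷ v) = trans (cong suc (wt-⊕ u v)) (sym (ℕₚ.+-suc (wt u) (wt v)))
wt-⊕ (1ℙ ∷ u) (0ℙ ∷ v) = cong suc (wt-⊕ u v)
wt-⊕ (1ℙ ∷ u) (1ℙ ∷ v) = begin
  wt (u ⊕ v) ℕ.+ 2 ℕ.* suc (commonOnes u v)       ≡⟨ pull (wt (u ⊕ v)) (commonOnes u v) ⟩
  2 ℕ.+ (wt (u ⊕ v) ℕ.+ 2 ℕ.* commonOnes u v)     ≡⟨ cong (2 ℕ.+_) (wt-⊕ u v) ⟩
  2 ℕ.+ (wt u ℕ.+ wt v)                        ≡⟨ cong suc (ℕₚ.+-suc (wt u) (wt v)) ⟨
  suc (wt u) ℕ.+ suc (wt v)                    ∎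
  where
  pull : ∀ a b → a ℕ.+ 2 ℕ.* suc b ≡ 2 ℕ.+ (a ℕ.+ 2 ℕ.* b)
  pull = ℕ-Ring.solve-∀

wt-𝟎 : ∀ n → wt (𝟎 {n}) ≡ 0
wt-𝟎 zero    = refl
wt-𝟎 (suc n) = wt-𝟎 n

wt-𝟏 : ∀ n → wt (𝟏 {n}) ≡ n
wt-𝟏 zero    = refl
wt-𝟏 (suc n) = cong suc (wt-𝟏 n)

wt-complement : ∀ {n} (u : Word n) → wt (𝟏 ⊕ u) ℕ.+ wt u ≡ n
wt-complement []       = refl
wt-complement (0ℙ ∷ u) = cong suc (wt-complement u)
wt-complement (1ℙ ∷ u) = trans (ℕₚ.+-suc (wt (𝟏 ⊕ u)) (wt u)) (cong suc (wt-complement u))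

parity-2* : ∀ m → parity (2 ℕ.* m) ≡ 0ℙ
parity-2* = ℙₚ.*-homo-* 2

even⇒2* : ∀ m → parity m ≡ 0ℙ → m ≡ 2 ℕ.* ⌊ m /2⌋
even⇒2* zero          _  = refl
even⇒2* (suc (suc m)) eq =
  trans (cong (suc ∘ suc) (even⇒2* m eq)) (sym (ℕₚ.*-suc 2 ⌊ m /2⌋))

-- On words of even weight this vanishes exactly when 4 divides the weight.
halfParity : ∀ {n} → Word n → Parity
halfParity v = parity ⌊ wt v /2⌋

-- By `wt-⊕` the half weights of `u` and `v` add up to the half weight of the sum plus the number of
-- common ones, which is even by orthogonality.
halfParity-⊕ : ∀ {n} {u v : Word n} → parity (wt u) ≡ 0ℙ → parity (wt v) ≡ 0ℙ → ⟨ u , v ⟩ ≡ 0ℙ →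
               halfParity (u ⊕ v) ≡ halfParity u ℙ.+ halfParity v
halfParity-⊕ {u = u} {v} u-even v-even u⊥v = begin
  parity ⌊ s /2⌋                        ≡⟨ ℙₚ.+-identityʳ _ ⟨
  parity ⌊ s /2⌋ ℙ.+ 0ℙ                 ≡⟨ cong (parity ⌊ s /2⌋ ℙ.+_) (parity-2* ⌊ o /2⌋) ⟨
  parity ⌊ s /2⌋ ℙ.+ parity (2 ℕ.* ⌊ o /2⌋) ≡⟨ ℙₚ.+-homo-+ ⌊ s /2⌋ _ ⟨
  parity (⌊ s /2⌋ ℕ.+ 2 ℕ.* ⌊ o /2⌋)    ≡⟨ cong parity halves ⟩
  parity (⌊ wt u /2⌋ ℕ.+ ⌊ wt v /2⌋)    ≡⟨ ℙₚ.+-homo-+ ⌊ wt u /2⌋ _ ⟩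
  halfParity u ℙ.+ halfParity v         ∎
  where
  s = wt (u ⊕ v)
  o = commonOnes u v
  o-even : o ≡ 2 ℕ.* ⌊ o /2⌋
  o-even = even⇒2* o (trans (parity-commonOnes u v) u⊥v)
  s-even : parity s ≡ 0ℙ
  s-even = begin
    parity s                               ≡⟨ ℙₚ.+-identityʳ _ ⟨
    parity s ℙ.+ 0ℙ                        ≡⟨ cong (parity s ℙ.+_) (parity-2* o) ⟨
    parity s ℙ.+ parity (2 ℕ.* o)          ≡⟨ ℙₚ.+-homo-+ s _ ⟨
    parity (s ℕ.+ 2 ℕ.* o)                 ≡⟨ cong parity (wt-⊕ u v) ⟩
    parity (wt u ℕ.+ wt v)                 ≡⟨ ℙₚ.+-homo-+ (wt u) _ ⟩
    parity (wt u) ℙ.+ parity (wt v)        ≡⟨ cong₂ ℙ._+_ u-even v-even ⟩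
    0ℙ                                     ∎
  doubled : 2 ℕ.* (⌊ s /2⌋ ℕ.+ 2 ℕ.* ⌊ o /2⌋) ≡ 2 ℕ.* (⌊ wt u /2⌋ ℕ.+ ⌊ wt v /2⌋)
  doubled = begin
    2 ℕ.* (⌊ s /2⌋ ℕ.+ 2 ℕ.* ⌊ o /2⌋)          ≡⟨ ℕₚ.*-distribˡ-+ 2 ⌊ s /2⌋ _ ⟩
    2 ℕ.* ⌊ s /2⌋ ℕ.+ 2 ℕ.* (2 ℕ.* ⌊ o /2⌋)    ≡⟨ cong₂ (λ p q → p ℕ.+ 2 ℕ.* q) (even⇒2* s s-even) o-even ⟨
    s ℕ.+ 2 ℕ.* o                              ≡⟨ wt-⊕ u v ⟩
    wt u ℕ.+ wt v                              ≡⟨ cong₂ ℕ._+_ (even⇒2* (wt u) u-even) (even⇒2* (wt v) v-even) ⟩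
    2 ℕ.* ⌊ wt u /2⌋ ℕ.+ 2 ℕ.* ⌊ wt v /2⌋      ≡⟨ ℕₚ.*-distribˡ-+ 2 ⌊ wt u /2⌋ _ ⟨
    2 ℕ.* (⌊ wt u /2⌋ ℕ.+ ⌊ wt v /2⌋)          ∎
  halves : ⌊ s /2⌋ ℕ.+ 2 ℕ.* ⌊ o /2⌋ ≡ ⌊ wt u /2⌋ ℕ.+ ⌊ wt v /2⌋
  halves = ℕₚ.*-cancelˡ-≡ _ _ 2 doubled

even-halves⇒4* : ∀ m → parity m ≡ 0ℙ → parity ⌊ m /2⌋ ≡ 0ℙ → m ≡ ⌊ ⌊ m /2⌋ /2⌋ ℕ.* 4
even-halves⇒4* m m-even half-even = begin
  m                                 ≡⟨ even⇒2* m m-even ⟩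
  2 ℕ.* ⌊ m /2⌋                     ≡⟨ cong (2 ℕ.*_) (even⇒2* ⌊ m /2⌋ half-even) ⟩
  2 ℕ.* (2 ℕ.* ⌊ ⌊ m /2⌋ /2⌋)       ≡⟨ regroup ⌊ ⌊ m /2⌋ /2⌋ ⟩
  ⌊ ⌊ m /2⌋ /2⌋ ℕ.* 4               ∎
  where
  regroup : ∀ j → 2 ℕ.* (2 ℕ.* j) ≡ j ℕ.* 4
  regroup = ℕ-Ring.solve-∀

parity-half-+4* : ∀ r j → parity ⌊ r ℕ.+ j ℕ.* 4 /2⌋ ≡ parity ⌊ r /2⌋
parity-half-+4* r zero    = cong (λ m → parity ⌊ m /2⌋) (ℕₚ.+-identityʳ r)
parity-half-+4* r (suc j) =
  trans (cong (λ m → parity ⌊ m /2⌋) (pull r (j ℕ.* 4))) (parity-half-+4* r j)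
  where
  pull : ∀ r m → r ℕ.+ (4 ℕ.+ m) ≡ 4 ℕ.+ (r ℕ.+ m)
  pull = ℕ-Ring.solve-∀

parity-half-% : ∀ m → parity ⌊ m /2⌋ ≡ parity ⌊ m % 4 /2⌋
parity-half-% m = trans (cong (λ m → parity ⌊ m /2⌋) (ℕ-DivMod.m≡m%n+[m/n]*n m 4))
                        (parity-half-+4* (m % 4) (m ℕ./ 4))

-- Character sums over a code

linearCombination∈ : ∀ {n k} (C : Code n) xs {vs : Vec (Word n) k} →
                     VecAll (Codeword C) vs → Codeword C (linearCombination xs vs)
linearCombination∈ C []       []         = Code.𝟎-closed C
linearCombination∈ C (x ∷ xs) (v∈ ∷ vs∈) =
  Code.⊕-closed C (Code.⊙-closed C x v∈) (linearCombination∈ C xs vs∈)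

module _ {n} (C : Code n) (φ : Word n → Parity)
         (φ-⊕ : ∀ {u v} → Codeword C u → Codeword C v → φ (u ⊕ v) ≡ φ u ℙ.+ φ v) where

  φ-𝟎 : φ 𝟎 ≡ 0ℙ
  φ-𝟎 = begin
    φ 𝟎           ≡⟨ cong φ (⊕-self 𝟎) ⟨
    φ (𝟎 ⊕ 𝟎)     ≡⟨ φ-⊕ (Code.𝟎-closed C) (Code.𝟎-closed C) ⟩
    φ 𝟎 ℙ.+ φ 𝟎   ≡⟨ ℙₚ.p+p≡0ℙ (φ 𝟎) ⟩
    0ℙ            ∎

  φ-⊙⊕ : ∀ x {v w} → Codeword C v → Codeword C w → φ (x ⊙ v ⊕ w) ≡ x ℙ.* φ v ℙ.+ φ w
  φ-⊙⊕ 0ℙ {v} {w} v∈ w∈ = cong φ (trans (cong (_⊕ w) (0ℙ⊙ v)) (⊕-identityˡ w))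
  φ-⊙⊕ 1ℙ {v} {w} v∈ w∈ = trans (cong (λ u → φ (u ⊕ w)) (1ℙ⊙ v)) (φ-⊕ v∈ w∈)

  φ-linearCombination≡0 : ∀ {k} xs {vs : Vec (Word n) k} → VecAll (Codeword C) vs →
                          VecAll (λ v → φ v ≡ 0ℙ) vs → φ (linearCombination xs vs) ≡ 0ℙ
  φ-linearCombination≡0 []       []         []             = φ-𝟎
  φ-linearCombination≡0 (x ∷ xs) (v∈ ∷ vs∈) (φv≡0 ∷ φvs≡0) =
    trans (φ-⊙⊕ x v∈ (linearCombination∈ C xs vs∈))
      (cong₂ ℙ._+_ (trans (cong (x ℙ.*_) φv≡0) (ℙₚ.*-zeroʳ x)) (φ-linearCombination≡0 xs vs∈ φvs≡0))

  -- Adjoining a vector `v` turns the sum `rest` into `rest + sgn (φ v) * rest`, which is twice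
  -- `rest` or 0.
  ∑-character-basis : ∀ {k} {vs : Vec (Word n) k} → VecAll (Codeword C) vs →
    let total = ∑[ xs ∈ words k ] sgn (φ (linearCombination xs vs)) in
    (VecAll (λ v → φ v ≡ 0ℙ) vs × total ≡ + (2 ^ k)) ⊎
    ((∃[ v ] Codeword C v × φ v ≡ 1ℙ) × total ≡ 0ℤ)
  ∑-character-basis [] = inj₁ ([] , trans (∑-words-zero _) (cong sgn φ-𝟎))
  ∑-character-basis {suc k} {v ∷ vs} (v∈ ∷ vs∈) = go (∑-character-basis vs∈) (φ v) refl
    where
    total = ∑[ xs ∈ words (suc k) ] sgn (φ (linearCombination xs (v ∷ vs)))
    rest  = ∑[ xs ∈ words k ] sgn (φ (linearCombination xs vs))
    term : ∀ x xs → sgn (φ (x ⊙ v ⊕ linearCombination xs vs)) ≡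
                    sgn (x ℙ.* φ v) * sgn (φ (linearCombination xs vs))
    term x xs = trans (cong sgn (φ-⊙⊕ x v∈ (linearCombination∈ C xs vs∈))) (sgn-+ (x ℙ.* φ v) _)
    total≡ : total ≡ rest + sgn (φ v) * rest
    total≡ = trans (∑-words-suc k _) (cong₂ _+_
      (∑-cong (words k) (λ {xs} _ → trans (term 0ℙ xs) (ℤₚ.*-identityˡ _)))
      (trans (∑-cong (words k) (λ {xs} _ → term 1ℙ xs)) (∑-distribˡ-* (words k) (sgn (φ v)) _)))
    go : (VecAll (λ v → φ v ≡ 0ℙ) vs × rest ≡ + (2 ^ k)) ⊎
         ((∃[ v ] Codeword C v × φ v ≡ 1ℙ) × rest ≡ 0ℤ) → ∀ p → φ v ≡ p →
         (VecAll (λ v → φ v ≡ 0ℙ) (v ∷ vs) × total ≡ + (2 ^ suc k)) ⊎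
         ((∃[ v ] Codeword C v × φ v ≡ 1ℙ) × total ≡ 0ℤ)
    go (inj₁ (φvs≡0 , rest≡)) 0ℙ φv≡ = inj₁ (φv≡ ∷ φvs≡0 , (begin
      total                     ≡⟨ total≡ ⟩
      rest + sgn (φ v) * rest   ≡⟨ cong₂ (λ p r → r + sgn p * r) φv≡ rest≡ ⟩
      + (2 ^ k) + 1ℤ * + (2 ^ k) ≡⟨ cong (_+_ (+ (2 ^ k))) (ℤₚ.*-identityˡ (+ (2 ^ k))) ⟩
      + (2 ^ k ℕ.+ 2 ^ k)       ≡⟨ cong (λ m → + (2 ^ k ℕ.+ m)) (ℕₚ.+-identityʳ (2 ^ k)) ⟨
      + (2 ^ suc k)             ∎))
    -- The terms with coefficient `0ℙ` and `1ℙ` at `v` cancel in pairs, whatever `rest` is.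
    go _ 1ℙ φv≡ = inj₂ ((v , v∈ , φv≡) , (begin
      total                     ≡⟨ total≡ ⟩
      rest + sgn (φ v) * rest   ≡⟨ cong (λ p → rest + sgn p * rest) φv≡ ⟩
      rest + -1ℤ * rest         ≡⟨ cong (_+_ rest) (ℤₚ.-1*i≡-i rest) ⟩
      rest - rest               ≡⟨ ℤₚ.+-inverseʳ rest ⟩
      0ℤ                        ∎))
    go (inj₂ (witness , rest≡0)) 0ℙ φv≡ = inj₂ (witness , (begin
      total                     ≡⟨ total≡ ⟩
      rest + sgn (φ v) * rest   ≡⟨ cong (λ r → r + sgn (φ v) * r) rest≡0 ⟩
      0ℤ + sgn (φ v) * 0ℤ       ≡⟨ trans (ℤₚ.+-identityˡ _) (ℤₚ.*-zeroʳ (sgn (φ v))) ⟩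
      0ℤ                        ∎))

  ∑-character : ∀ {k} {vs : Vec (Word n) k} → IsBasis C vs →
    let total = ∑[ xs ∈ words k ] sgn (φ (linearCombination xs vs)) in
    ((∀ v → Codeword C v → φ v ≡ 0ℙ) × total ≡ + (2 ^ k)) ⊎
    ((∃[ v ] Codeword C v × φ v ≡ 1ℙ) × total ≡ 0ℤ)
  ∑-character {vs = vs} basis with ∑-character-basis (IsBasis.codewords basis)
  ... | inj₂ nontrivial        = inj₂ nontrivial
  ... | inj₁ (φvs≡0 , total≡) = inj₁ (trivial , total≡)
    where
    trivial : ∀ v → Codeword C v → φ v ≡ 0ℙ
    trivial v v∈ with IsBasis.spanning basis v v∈
    ... | xs , refl = φ-linearCombination≡0 xs (IsBasis.codewords basis) φvs≡0

_≟ʷ_ : ∀ {n} → DecidableEquality (Word n)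
_≟ʷ_ = Vecₚ.≡-dec ℙₚ._≟_

linearCombination-⊕ : ∀ {n k} xs ys (vs : Vec (Word n) k) →
  linearCombination (xs ⊕ ys) vs ≡ linearCombination xs vs ⊕ linearCombination ys vs
linearCombination-⊕ []       []       []       = sym (⊕-self 𝟎)
linearCombination-⊕ (x ∷ xs) (y ∷ ys) (v ∷ vs) =
  trans (cong₂ _⊕_ (⊙-distrib v) (linearCombination-⊕ xs ys vs))
        (⊕-interchange (x ⊙ v) (y ⊙ v) (linearCombination xs vs) (linearCombination ys vs))
  where
  ⊙-distrib : ∀ {n} (v : Word n) → (x ℙ.+ y) ⊙ v ≡ x ⊙ v ⊕ y ⊙ v
  ⊙-distrib []      = refl
  ⊙-distrib (z ∷ v) = cong₂ _∷_ (ℙₚ.*-distribʳ-+ z x y) (⊙-distrib v)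
  ⊕-interchange : ∀ {n} (a b c d : Word n) → (a ⊕ b) ⊕ (c ⊕ d) ≡ (a ⊕ c) ⊕ (b ⊕ d)
  ⊕-interchange []      []      []      []      = refl
  ⊕-interchange (p ∷ a) (q ∷ b) (r ∷ c) (s ∷ d) = cong₂ _∷_ (interchange p q r s) (⊕-interchange a b c d)

linearCombination-injective : ∀ {n k} {C : Code n} {vs : Vec (Word n) k} → IsBasis C vs →
  ∀ {xs ys} → linearCombination xs vs ≡ linearCombination ys vs → xs ≡ ys
linearCombination-injective {vs = vs} basis {xs} {ys} eq = sym (begin
  ys              ≡⟨ ⊕-cancel xs ys ⟨
  xs ⊕ (xs ⊕ ys)  ≡⟨ cong (xs ⊕_) (IsBasis.independent basis (xs ⊕ ys) (begin
    linearCombination (xs ⊕ ys) vs                     ≡⟨ linearCombination-⊕ xs ys vs ⟩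
    linearCombination xs vs ⊕ linearCombination ys vs  ≡⟨ cong (_⊕ linearCombination ys vs) eq ⟩
    linearCombination ys vs ⊕ linearCombination ys vs  ≡⟨ ⊕-self _ ⟩
    𝟎                                                  ∎)) ⟩
  xs ⊕ 𝟎          ≡⟨ Vecₚ.zipWith-identityʳ ℙₚ.+-identityʳ xs ⟩
  xs              ∎)

-- The doubly even subcode, the shadow and Poisson summation

module SinglyEvenSelfDual {n k} (C : Code n) {vs : Vec (Word n) k} (basis : IsBasis C vs)
                          (self-dual : SelfDual C) (singly-even : SinglyEven C) where

  orthogonal : ∀ {u v} → Codeword C u → Codeword C v → ⟨ u , v ⟩ ≡ 0ℙ
  orthogonal {u} {v} u∈ v∈ = Equivalence.to (self-dual u) u∈ v v∈

  even : ∀ {u} → Codeword C u → parity (wt u) ≡ 0ℙ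
  even {u} u∈ = trans (sym (⟨,⟩-self u)) (orthogonal u∈ u∈)

  -- Every word of a self-dual code is orthogonal to itself, hence even, hence orthogonal to the
  -- all-one word.
  𝟏∈ : Codeword C 𝟏
  𝟏∈ = Equivalence.from (self-dual 𝟏) λ w w∈ →
    trans (⟨,⟩-comm 𝟏 w) (trans (⟨,𝟏⟩ w) (even w∈))

  halfParity-additive : ∀ {u v} → Codeword C u → Codeword C v →
                        halfParity (u ⊕ v) ≡ halfParity u ℙ.+ halfParity v
  halfParity-additive {u} {v} u∈ v∈ = halfParity-⊕ {u = u} {v} (even u∈) (even v∈) (orthogonal u∈ v∈)

  doublyEven⇒ : ∀ {v} → DoublyEvenPart C v → halfParity v ≡ 0ℙ
  doublyEven⇒ {v} (v∈ , wt%4) = trans (parity-half-% (wt v)) (cong (λ r → parity ⌊ r /2⌋) wt%4)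

  doublyEven⇐ : ∀ {v} → Codeword C v → halfParity v ≡ 0ℙ → DoublyEvenPart C v
  doublyEven⇐ {v} v∈ half≡0 = v∈ ,
    trans (cong (_% 4) (even-halves⇒4* (wt v) (even v∈) half≡0)) (ℕ-DivMod.m*n%n≡0 ⌊ ⌊ wt v /2⌋ /2⌋ 4)

  halfParity-nontrivial : ¬ (∀ v → Codeword C v → halfParity v ≡ 0ℙ)
  halfParity-nontrivial trivial =
    let v , v∈ , wt%4 = singly-even in
    contradiction
      (trans (sym (trivial v v∈)) (trans (parity-half-% (wt v)) (cong (λ r → parity ⌊ r /2⌋) wt%4)))
      λ ()

  -- On C both sides are characters vanishing on C₀, which has index 2; the left one is not trivial,
  -- as otherwise `u` would lie in the dual of C, which is C.
  shadow-halfParity : ∀ {u} → Shadow C u → ∀ v → Codeword C v → ⟨ u , v ⟩ ≡ halfParity v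
  shadow-halfParity {u} (u⊥ , u∉) v v∈ = go (halfParity v) refl ⟨ u , v ⟩ refl
    where
    go : ∀ p → halfParity v ≡ p → ∀ q → ⟨ u , v ⟩ ≡ q → ⟨ u , v ⟩ ≡ halfParity v
    go 0ℙ half≡ _  _      = trans (u⊥ v (doublyEven⇐ v∈ half≡)) (sym half≡)
    go 1ℙ half≡ 1ℙ inner≡ = trans inner≡ (sym half≡)
    go 1ℙ half≡ 0ℙ inner≡ = contradiction (Equivalence.from (self-dual u) u⊥C) u∉
      where
      -- Two words of C outside C₀ add up to a word of C₀, so orthogonality to the single word `v`
      -- outside C₀ extends to all of C.
      u⊥C : ∀ w → Codeword C w → ⟨ u , w ⟩ ≡ 0ℙ
      u⊥C w w∈ with halfParity w in eq
      ... | 0ℙ = u⊥ w (doublyEven⇐ w∈ eq)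
      ... | 1ℙ = begin
        ⟨ u , w ⟩                 ≡⟨ cong (ℙ._+ ⟨ u , w ⟩) inner≡ ⟨
        ⟨ u , v ⟩ ℙ.+ ⟨ u , w ⟩   ≡⟨ ⟨,⟩-⊕ u v w ⟨
        ⟨ u , v ⊕ w ⟩             ≡⟨ u⊥ (v ⊕ w) (doublyEven⇐ (Code.⊕-closed C v∈ w∈)
                                       (trans (halfParity-additive v∈ w∈) (cong₂ ℙ._+_ half≡ eq))) ⟩
        0ℙ                        ∎

  -- This is `shadow-halfParity` at the all-one word; for n = 130 it makes all shadow weights odd.
  shadow-wt : ∀ {u} → Shadow C u → parity (wt u) ≡ parity ⌊ n /2⌋
  shadow-wt {u} u∈S = begin
    parity (wt u)   ≡⟨ ⟨,𝟏⟩ u ⟨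
    ⟨ u , 𝟏 {n} ⟩   ≡⟨ shadow-halfParity u∈S 𝟏 𝟏∈ ⟩
    halfParity (𝟏 {n}) ≡⟨ cong (λ m → parity ⌊ m /2⌋) (wt-𝟏 n) ⟩
    parity ⌊ n /2⌋  ∎

  codewordOf : Vec 𝔽₂ k → Word n
  codewordOf xs = linearCombination xs vs

  -- Equal to 2 on C₀ and to 0 on the rest of C; the factor 2 avoids a division.
  2×doublyEven : Word n → ℤ
  2×doublyEven c = 1ℤ + sgn (halfParity c)

  -- Twice the sum of the character of `u` over C₀. It is 2 to the power k on the dual of C₀, which
  -- is C together with S, and 0 elsewhere.
  correlation : Word n → ℤ
  correlation u = ∑[ xs ∈ words k ] 2×doublyEven (codewordOf xs) * sgn ⟨ u , codewordOf xs ⟩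

  -- For fixed `u` both are characters of C: the first is trivial exactly for `u` in C, the second
  -- exactly for `u` in S.
  φ₁ φ₂ : Word n → Word n → Parity
  φ₁ u c = ⟨ u , c ⟩
  φ₂ u c = halfParity c ℙ.+ ⟨ u , c ⟩

  total₁ total₂ : Word n → ℤ
  total₁ u = ∑[ xs ∈ words k ] sgn (φ₁ u (codewordOf xs))
  total₂ u = ∑[ xs ∈ words k ] sgn (φ₂ u (codewordOf xs))

  correlation≡ : ∀ u → correlation u ≡ total₁ u + total₂ u
  correlation≡ u = trans (∑-cong (words k) (λ {xs} _ → split (codewordOf xs))) (∑-distrib-+ (words k) _ _)
    where
    split : ∀ c → 2×doublyEven c * sgn ⟨ u , c ⟩ ≡ sgn (φ₁ u c) + sgn (φ₂ u c)
    split c = begin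
      (1ℤ + sgn (halfParity c)) * sgn ⟨ u , c ⟩
        ≡⟨ ℤₚ.*-distribʳ-+ (sgn ⟨ u , c ⟩) 1ℤ (sgn (halfParity c)) ⟩
      1ℤ * sgn ⟨ u , c ⟩ + sgn (halfParity c) * sgn ⟨ u , c ⟩
        ≡⟨ cong₂ _+_ (ℤₚ.*-identityˡ (sgn ⟨ u , c ⟩)) (sym (sgn-+ (halfParity c) ⟨ u , c ⟩)) ⟩
      sgn (φ₁ u c) + sgn (φ₂ u c) ∎

  sum₁ : ∀ u → ((∀ v → Codeword C v → φ₁ u v ≡ 0ℙ) × total₁ u ≡ + (2 ^ k)) ⊎
               ((∃[ v ] Codeword C v × φ₁ u v ≡ 1ℙ) × total₁ u ≡ 0ℤ)
  sum₁ u = ∑-character C (φ₁ u) (λ {v} {w} _ _ → ⟨,⟩-⊕ u v w) basis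

  sum₂ : ∀ u → ((∀ v → Codeword C v → φ₂ u v ≡ 0ℙ) × total₂ u ≡ + (2 ^ k)) ⊎
               ((∃[ v ] Codeword C v × φ₂ u v ≡ 1ℙ) × total₂ u ≡ 0ℤ)
  sum₂ u = ∑-character C (φ₂ u) additive basis
    where
    additive : ∀ {v w} → Codeword C v → Codeword C w → φ₂ u (v ⊕ w) ≡ φ₂ u v ℙ.+ φ₂ u w
    additive {v} {w} v∈ w∈ = trans (cong₂ ℙ._+_ (halfParity-additive v∈ w∈) (⟨,⟩-⊕ u v w))
      (interchange (halfParity v) (halfParity w) ⟨ u , v ⟩ ⟨ u , w ⟩)

  φ₂≡0⇒ : ∀ {u v} → φ₂ u v ≡ 0ℙ → ⟨ u , v ⟩ ≡ halfParity v
  φ₂≡0⇒ {u} {v} eq = ℙₚ.+-cancelˡ-≡ (halfParity v) ⟨ u , v ⟩ (halfParity v)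
    (trans eq (sym (ℙₚ.p+p≡0ℙ (halfParity v))))

  -- `φ₁ u` is trivial by self-duality; were `φ₂ u` trivial too, `halfParity` would vanish on C,
  -- against the word of weight 2 modulo 4.
  correlation-codeword : ∀ {u} → Codeword C u → correlation u ≡ + (2 ^ k)
  correlation-codeword {u} u∈ with sum₁ u | sum₂ u
  ... | inj₂ ((v , v∈ , eq) , _) | _ = contradiction (trans (sym (orthogonal u∈ v∈)) eq) λ ()
  ... | inj₁ _ | inj₁ (trivial , _)  = contradiction
    (λ v v∈ → trans (sym (φ₂≡0⇒ {u} {v} (trivial v v∈))) (orthogonal u∈ v∈)) halfParity-nontrivial
  ... | inj₁ (_ , eq₁) | inj₂ (_ , eq₂) =
    trans (correlation≡ u) (trans (cong₂ _+_ eq₁ eq₂) (ℤₚ.+-identityʳ _))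

  -- The roles are exchanged: `φ₂ u` is trivial by `shadow-halfParity`, and `φ₁ u` is not, since `u`
  -- lies outside C.
  correlation-shadow : ∀ {u} → Shadow C u → correlation u ≡ + (2 ^ k)
  correlation-shadow {u} u∈S@(_ , u∉) with sum₁ u | sum₂ u
  ... | inj₁ (u⊥C , _) | _ = contradiction (Equivalence.from (self-dual u) u⊥C) u∉
  ... | inj₂ _ | inj₂ ((v , v∈ , eq) , _) = contradiction
    (trans (sym (trans (cong (halfParity v ℙ.+_) (shadow-halfParity u∈S v v∈)) (ℙₚ.p+p≡0ℙ (halfParity v)))) eq)
    λ ()
  ... | inj₂ (_ , eq₁) | inj₁ (_ , eq₂) =
    trans (correlation≡ u) (trans (cong₂ _+_ eq₁ eq₂) (ℤₚ.+-identityˡ _))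

  correlation-support : ∀ u → (Codeword C u ⊎ Shadow C u) ⊎ correlation u ≡ 0ℤ
  correlation-support u with sum₁ u | sum₂ u
  ... | inj₁ (u⊥C , _) | _                  = inj₁ (inj₁ (Equivalence.from (self-dual u) u⊥C))
  ... | inj₂ _         | inj₁ (trivial , _) = inj₁ (inj₂
    ( (λ v v∈C₀ → trans (φ₂≡0⇒ {u} {v} (trivial v (proj₁ v∈C₀))) (doublyEven⇒ v∈C₀))
    , (λ u∈C → halfParity-nontrivial
        (λ v v∈ → trans (sym (φ₂≡0⇒ {u} {v} (trivial v v∈))) (orthogonal u∈C v∈)))))
  ... | inj₂ (_ , eq₁) | inj₂ (_ , eq₂)     = inj₂ (trans (correlation≡ u) (cong₂ _+_ eq₁ eq₂))

  -- After the two sums are interchanged, the inner sum over codewords is `correlation u`.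
  poisson : ∀ g → ∑[ xs ∈ words k ] 2×doublyEven (codewordOf xs) * 𝓕 g (codewordOf xs) ≡
                  ∑[ u ∈ words n ] correlation u * g u
  poisson g = begin
    ∑[ xs ∈ words k ] 2×doublyEven (codewordOf xs) * 𝓕 g (codewordOf xs)
      ≡⟨ ∑-cong (words k) (λ {xs} _ → ∑-distribˡ-* (words n) (2×doublyEven (codewordOf xs)) _) ⟨
    ∑[ xs ∈ words k ] ∑[ u ∈ words n ] term xs u
      ≡⟨ ∑-swap (words k) (words n) term ⟩
    ∑[ u ∈ words n ] ∑[ xs ∈ words k ] term xs u
      ≡⟨ ∑-cong (words n) (λ {u} _ → collect u) ⟩
    ∑[ u ∈ words n ] correlation u * g u ∎
    where
    term : Vec 𝔽₂ k → Word n → ℤ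
    term xs u = 2×doublyEven (codewordOf xs) * (sgn ⟨ u , codewordOf xs ⟩ * g u)
    rotate : ∀ a b c → a * (b * c) ≡ c * (a * b)
    rotate = ℤ-Ring.solve-∀
    collect : ∀ u → ∑[ xs ∈ words k ] term xs u ≡ correlation u * g u
    collect u = begin
      ∑[ xs ∈ words k ] term xs u
        ≡⟨ ∑-cong (words k) (λ {xs} _ → rotate (2×doublyEven (codewordOf xs)) _ (g u)) ⟩
      ∑[ xs ∈ words k ] g u * (2×doublyEven (codewordOf xs) * sgn ⟨ u , codewordOf xs ⟩)
        ≡⟨ ∑-distribˡ-* (words k) (g u) _ ⟩
      g u * correlation u
        ≡⟨ ℤₚ.*-comm (g u) _ ⟩
      correlation u * g u ∎

  codewords : List (Word n)
  codewords = map codewordOf (words k)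

  codewords-unique : Unique codewords
  codewords-unique = Unique.map⁺ (linearCombination-injective basis) (words-unique k)

  ∈-codewords⁺ : ∀ {c} → Codeword C c → c ∈ codewords
  ∈-codewords⁺ {c} c∈ =
    let xs , eq = IsBasis.spanning basis c c∈ in
    subst (_∈ codewords) eq (∈-map⁺ codewordOf (∈-words xs))

  ∈-codewords⁻ : ∀ {c} → c ∈ codewords → Codeword C c
  ∈-codewords⁻ c∈ =
    let xs , _ , eq = ∈-map⁻ codewordOf c∈ in
    subst (Codeword C) (sym eq) (linearCombination∈ C xs (IsBasis.codewords basis))

  -- Both sides of `poisson` are restricted to lists that catch their nonzero terms: `cs` for the
  -- words of C on the transform side, `us` for the words of C and S on the other, where
  -- `correlation` is constant.
  poisson-support : ∀ g f {cs us} → (∀ c → 2×doublyEven c * 𝓕 g c ≡ f c) →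
    Unique cs → Unique us →
    (∀ {c} → c ∈ cs → Codeword C c) →
    (∀ {c} → Codeword C c → c ∉ cs → f c ≡ 0ℤ) →
    (∀ {u} → u ∈ us → Codeword C u ⊎ Shadow C u) →
    (∀ {u} → Codeword C u ⊎ Shadow C u → u ∉ us → g u ≡ 0ℤ) →
    ∑ cs f ≡ + (2 ^ k) * ∑ us g
  poisson-support g f {cs} {us} f≡ cs! us! cs⊆C f≡0 us⊆C∪S g≡0 = begin
    ∑ cs f
      ≡⟨ ∑-support _≟ʷ_ f codewords-unique cs! (∈-codewords⁺ ∘ cs⊆C) (f≡0 ∘ ∈-codewords⁻) ⟨
    ∑ codewords f
      ≡⟨ ∑-map codewordOf (words k) f ⟩
    ∑[ xs ∈ words k ] f (codewordOf xs)
      ≡⟨ ∑-cong (words k) (λ {xs} _ → f≡ (codewordOf xs)) ⟨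
    ∑[ xs ∈ words k ] 2×doublyEven (codewordOf xs) * 𝓕 g (codewordOf xs)
      ≡⟨ poisson g ⟩
    ∑[ u ∈ words n ] correlation u * g u
      ≡⟨ ∑-support _≟ʷ_ _ (words-unique n) us! (λ {u} _ → ∈-words u) (λ {u} _ → vanish u) ⟩
    ∑[ u ∈ us ] correlation u * g u
      ≡⟨ ∑-cong us (λ {u} u∈ → cong (_* g u) (constant (us⊆C∪S u∈))) ⟩
    ∑[ u ∈ us ] + (2 ^ k) * g u
      ≡⟨ ∑-distribˡ-* us (+ (2 ^ k)) g ⟩
    + (2 ^ k) * ∑ us g ∎
    where
    constant : ∀ {u} → Codeword C u ⊎ Shadow C u → correlation u ≡ + (2 ^ k)
    constant (inj₁ u∈C) = correlation-codeword u∈C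
    constant (inj₂ u∈S) = correlation-shadow u∈S
    vanish : ∀ u → u ∉ us → correlation u * g u ≡ 0ℤ
    vanish u u∉ with correlation-support u
    ... | inj₁ u∈C∪S = trans (cong (correlation u *_) (g≡0 u∈C∪S u∉)) (ℤₚ.*-zeroʳ (correlation u))
    ... | inj₂ eq    = cong (_* g u) eq

-- Weight enumerators

≢⇒≡ᵇ-false : ∀ {i j} → i ≢ j → (i ≡ᵇ j) ≡ false
≢⇒≡ᵇ-false {i} {j} i≢j with i ≡ᵇ j in eq
... | false = refl
... | true  = contradiction (ℕₚ.≡ᵇ⇒≡ i j (subst T (sym eq) _)) i≢j

≡ᵇ-refl : ∀ i → (i ≡ᵇ i) ≡ true
≡ᵇ-refl zero    = refl
≡ᵇ-refl (suc i) = ≡ᵇ-refl i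

coefficient-∉ : ∀ {i} ts → i ∉ map proj₂ ts → coefficient ts i ≡ 0ℤ
coefficient-∉ []             _  = refl
coefficient-∉ ((c , j) ∷ ts) i∉ = cong₂ (λ b x → (if b then c else 0ℤ) + x)
  (≢⇒≡ᵇ-false (i∉ ∘ here ∘ sym)) (coefficient-∉ ts (i∉ ∘ there))

coefficient-∈ : ∀ {c i ts} → Unique (map proj₂ ts) → (c , i) ∈ ts → coefficient ts i ≡ c
coefficient-∈ {c} {i} {_ ∷ ts} ts!@(_ ∷ _) (here refl) = trans
  (cong₂ (λ b x → (if b then c else 0ℤ) + x) (≡ᵇ-refl i)
         (coefficient-∉ ts (Unique.Unique[x∷xs]⇒x∉xs ts!)))
  (ℤₚ.+-identityʳ c)
coefficient-∈ {c} {i} {(c′ , j) ∷ ts} (j∉ ∷ ts!) (there c∈) = trans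
  (cong₂ (λ b x → (if b then c′ else 0ℤ) + x)
         (≢⇒≡ᵇ-false (All.lookup j∉ (∈-map⁺ proj₂ c∈))) (coefficient-∈ ts! c∈))
  (ℤₚ.+-identityˡ c)

module WeightClasses {n} {P : Pred (Word n) 0ℓ} {W} (enumerator : IsWeightEnumerator P W) where

  ofWeight : ℕ → List (Word n)
  ofWeight i = proj₁ (enumerator i)

  ofWeight-unique : ∀ i → Unique (ofWeight i)
  ofWeight-unique i = proj₁ (proj₂ (enumerator i))

  length-ofWeight : ∀ i → length (ofWeight i) ≡ W i
  length-ofWeight i = proj₂ (proj₂ (proj₂ (enumerator i)))

  ∈-ofWeight⁺ : ∀ {i v} → P v → wt v ≡ i → v ∈ ofWeight i
  ∈-ofWeight⁺ {i} {v} Pv wt≡ = Equivalence.from (proj₁ (proj₂ (proj₂ (enumerator i))) v) (Pv , wt≡)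

  ∈-ofWeight⁻ : ∀ {i v} → v ∈ ofWeight i → P v × wt v ≡ i
  ∈-ofWeight⁻ {i} {v} = Equivalence.to (proj₁ (proj₂ (proj₂ (enumerator i))) v)

  ofWeights : List ℕ → List (Word n)
  ofWeights = concatMap ofWeight

  ∈-ofWeights⁺ : ∀ {is v} → P v → wt v ∈ is → v ∈ ofWeights is
  ∈-ofWeights⁺ Pv wt∈ = ∈-concat⁺′ (∈-ofWeight⁺ Pv refl) (∈-map⁺ ofWeight wt∈)

  ∈-ofWeights⁻ : ∀ is {v} → v ∈ ofWeights is → P v × wt v ∈ is
  ∈-ofWeights⁻ is v∈ with ∈-concat⁻′ (map ofWeight is) v∈
  ... | _ , v∈xs , xs∈ with ∈-map⁻ ofWeight xs∈
  ... | i , i∈ , refl with ∈-ofWeight⁻ v∈xs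
  ... | Pv , refl = Pv , i∈

  ofWeights-unique : ∀ {is} → Unique is → Unique (ofWeights is)
  ofWeights-unique is! = Unique.concat⁺ (Allₚ.map⁺ (All.universal ofWeight-unique _))
    (AllPairsₚ.map⁺ (AllPairs.map disjoint is!))
    where
    disjoint : ∀ {i j} → i ≢ j → Disjoint (ofWeight i) (ofWeight j)
    disjoint i≢j (v∈i , v∈j) =
      i≢j (trans (sym (proj₂ (∈-ofWeight⁻ v∈i))) (proj₂ (∈-ofWeight⁻ v∈j)))

  -- An exponent below m that is absent from the terms has coefficient 0, so its weight class is
  -- empty.
  wt∈exponents : ∀ {ts m v} → W ≐ ts +O[y^ m ] → P v → wt v < m → wt v ∈ map proj₂ ts
  wt∈exponents {ts} {m} {v} W≐ Pv wt<m with DecMembership._∈?_ ℕₚ._≟_ (wt v) (map proj₂ ts)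
  ... | yes wt∈ = wt∈
  ... | no  wt∉ = contradiction (∈-ofWeight⁺ Pv refl) (empty (ofWeight (wt v)) length≡0)
    where
    length≡0 : length (ofWeight (wt v)) ≡ 0
    length≡0 = trans (length-ofWeight (wt v))
      (ℤₚ.+-injective (trans (W≐ (wt v) wt<m) (coefficient-∉ ts wt∉)))
    empty : ∀ xs → length xs ≡ 0 → v ∉ xs
    empty [] _ ()

  length≡coefficient : ∀ {ts m c i} → W ≐ ts +O[y^ m ] → Unique (map proj₂ ts) → (c , i) ∈ ts →
                       i < m → + length (ofWeight i) ≡ c
  length≡coefficient {i = i} W≐ ts! c∈ i<m =
    trans (cong +_ (length-ofWeight i)) (trans (W≐ i i<m) (coefficient-∈ ts! c∈))

-- Sums over a weight class, split by the first coordinate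

bit : Parity → ℤ
bit 0ℙ = 0ℤ
bit 1ℙ = 1ℤ

headOnes : ∀ {n} → List (Word (suc n)) → ℤ
headOnes xs = ∑[ v ∈ xs ] bit (Vec.head v)

-- In the class of weight i, a word beginning with 0 has tail weight i and one beginning with 1 has
-- tail weight i - 1. No word beginning with 1 has weight 0, so `pred 0` is harmless.
∑-value : ∀ {n} s t i (xs : List (Word (suc n))) → (∀ {v} → v ∈ xs → wt v ≡ i) →
  ∑ xs (value (s , t)) ≡ at s i * (+ length xs - headOnes xs) + at t (pred i) * headOnes xs
∑-value s t i []       wt≡ = sym (cong₂ _+_ (ℤₚ.*-zeroʳ (at s i)) (ℤₚ.*-zeroʳ (at t (pred i))))
∑-value s t i (v ∷ xs) wt≡ = begin
  value (s , t) v + ∑ xs (value (s , t))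
    ≡⟨ cong₂ _+_ (value-bit v (wt≡ (here refl))) (∑-value s t i xs (wt≡ ∘ there)) ⟩
  (x * (1ℤ - bit (Vec.head v)) + y * bit (Vec.head v)) + (x * (+ length xs - headOnes xs) + y * headOnes xs)
    ≡⟨ collect x y (bit (Vec.head v)) (+ length xs) (headOnes xs) ⟩
  x * (1ℤ + + length xs - (bit (Vec.head v) + headOnes xs)) + y * (bit (Vec.head v) + headOnes xs) ∎
  where
  x = at s i
  y = at t (pred i)
  value-bit : ∀ v → wt v ≡ i → value (s , t) v ≡ x * (1ℤ - bit (Vec.head v)) + y * bit (Vec.head v)
  value-bit (0ℙ ∷ u) refl = sym (trans (cong₂ _+_ (ℤₚ.*-identityʳ x) (ℤₚ.*-zeroʳ y)) (ℤₚ.+-identityʳ x))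
  value-bit (1ℙ ∷ u) refl = sym (trans (cong₂ _+_ (ℤₚ.*-zeroʳ x) (ℤₚ.*-identityʳ y)) (ℤₚ.+-identityˡ y))
  collect : ∀ x y b l o → (x * (1ℤ - b) + y * b) + (x * (l - o) + y * o) ≡ x * (1ℤ + l - (b + o)) + y * (b + o)
  collect = ℤ-Ring.solve-∀

∑-value-class : ∀ {n} s t i (xs : List (Word (suc n))) {x y l} → (∀ {v} → v ∈ xs → wt v ≡ i) →
  at s i ≡ x → at t (pred i) ≡ y → + length xs ≡ l →
  ∑ xs (value (s , t)) ≡ x * (l - headOnes xs) + y * headOnes xs
∑-value-class s t i xs wt≡ refl refl refl = ∑-value s t i xs wt≡

∑-sgn-head : ∀ {n} (xs : List (Word (suc n))) → ∑[ v ∈ xs ] sgn (Vec.head v) ≡ + length xs - + 2 * headOnes xs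
∑-sgn-head []       = refl
∑-sgn-head (v ∷ xs) = begin
  sgn (Vec.head v) + (∑[ v ∈ xs ] sgn (Vec.head v))
    ≡⟨ cong₂ _+_ (sgn-bit (Vec.head v)) (∑-sgn-head xs) ⟩
  (1ℤ - + 2 * bit (Vec.head v)) + (+ length xs - + 2 * headOnes xs)
    ≡⟨ collect (bit (Vec.head v)) (+ length xs) (headOnes xs) ⟩
  1ℤ + + length xs - + 2 * (bit (Vec.head v) + headOnes xs) ∎
  where
  sgn-bit : ∀ p → sgn p ≡ 1ℤ - + 2 * bit p
  sgn-bit 0ℙ = refl
  sgn-bit 1ℙ = refl
  collect : ∀ b l o → (1ℤ - + 2 * b) + (l - + 2 * o) ≡ 1ℤ + l - + 2 * (b + o)
  collect = ℤ-Ring.solve-∀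

-- The polynomial Q and the table of Q(A) δ at length 130

-- The eigenvalues 130 - 2w for the doubly even weights w = 24, 28, …, 104.
root : ℕ → ℤ
root i = + 82 - + 8 * + i

roots : List ℤ
roots = applyUpTo root 21

-- These constants are abstract since Agda would otherwise unfold a product of
-- one of them with an open term in unary.
abstract
  Q : ℤ → ℤ
  Q x = ∏⟨ x - roots ⟩

  -- The common factors of the values below.
  K P : ℤ
  K = + (21 !)
  P = + (2 ^ 63)

  -- The values of Q(A) δ depend only on the distance to the first unit vector. This is the tail
  -- weight for a word beginning with 1 and one more for a word beginning with 0, so `T₀` is `T₁`
  -- without its first entry.
  T₀ T₁ : List ℤ
  T₀ = map (K *_) (
    + 95680 ∷ - (+ 29900) ∷ + 29900 ∷ - (+ 29900) ∷ + 17250 ∷ - (+ 4600) ∷ + 4600 ∷ - (+ 4600)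
    ∷ + 2576 ∷ - (+ 552) ∷ + 552 ∷ - (+ 552) ∷ + 299 ∷ - (+ 46) ∷ + 46 ∷ - (+ 46) ∷ + 24
    ∷ - (+ 2) ∷ + 2 ∷ - (+ 2) ∷ + 1 ∷ [])
  T₁ = map (K *_) (
    - (+ 161460) ∷ + 95680 ∷ - (+ 29900) ∷ + 29900 ∷ - (+ 29900) ∷ + 17250 ∷ - (+ 4600)
    ∷ + 4600 ∷ - (+ 4600) ∷ + 2576 ∷ - (+ 552) ∷ + 552 ∷ - (+ 552) ∷ + 299 ∷ - (+ 46) ∷ + 46
    ∷ - (+ 46) ∷ + 24 ∷ - (+ 2) ∷ + 2 ∷ - (+ 2) ∷ + 1 ∷ [])

  Q≡ : ∀ x → Q x ≡ ∏⟨ x - roots ⟩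
  Q≡ x = refl

  -- The product of 48 + 8i for i from 0 to 20 is 8^21 times 26! / 5!, and 26! / (5! 21!) = 65780 =
  -- 2 * 32890.
  Q-130 : Q (+ 130) ≡ + 2 * (P * K) * + 32890
  Q-130 = refl

  -- The 21 factors are -8 times 21, 20, ..., 1.
  Q--86 : Q (- (+ 86)) ≡ - (P * K)
  Q--86 = refl

  2^65≡4*P : + (2 ^ 65) ≡ + 4 * P
  2^65≡4*P = refl

  4*P*K≢0 : + 4 * P * K ≢ 0ℤ
  4*P*K≢0 ()

  table≡ : table 129 roots ≡ (T₀ , T₁)
  table≡ = pair-≡ (table 129 roots)
    (toWitness {a? = Listₚ.≡-dec ℤₚ._≟_ (proj₁ (table 129 roots)) T₀} _)
    (toWitness {a? = Listₚ.≡-dec ℤₚ._≟_ (proj₂ (table 129 roots)) T₁} _)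
    where
    pair-≡ : ∀ (p : Table) {s t} → proj₁ p ≡ s → proj₂ p ≡ t → p ≡ (s , t)
    pair-≡ p refl refl = refl

  length-T₀ : length T₀ ≡ 21
  length-T₀ = refl

  length-T₁ : length T₁ ≡ 22
  length-T₁ = refl

  at-T₀-0 : at T₀ 0 ≡ K * + 95680
  at-T₀-0 = refl

  at-T₀-5 : at T₀ 5 ≡ K * - (+ 4600)
  at-T₀-5 = refl

  at-T₀-9 : at T₀ 9 ≡ K * - (+ 552)
  at-T₀-9 = refl

  at-T₀-13 : at T₀ 13 ≡ K * - (+ 46)
  at-T₀-13 = refl

  at-T₀-17 : at T₀ 17 ≡ K * - (+ 2)
  at-T₀-17 = refl

  at-T₀-21 : at T₀ 21 ≡ K * 0ℤ
  at-T₀-21 = refl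

  at-T₀-22 : at T₀ 22 ≡ K * 0ℤ
  at-T₀-22 = refl

  at-T₁-4 : at T₁ 4 ≡ K * - (+ 29900)
  at-T₁-4 = refl

  at-T₁-8 : at T₁ 8 ≡ K * - (+ 4600)
  at-T₁-8 = refl

  at-T₁-12 : at T₁ 12 ≡ K * - (+ 552)
  at-T₁-12 = refl

  at-T₁-16 : at T₁ 16 ≡ K * - (+ 46)
  at-T₁-16 = refl

  at-T₁-20 : at T₁ 20 ≡ K * - (+ 2)
  at-T₁-20 = refl

  at-T₁-21 : at T₁ 21 ≡ K * + 1
  at-T₁-21 = refl

-- The relation between the integers as a polynomial identity

codeTerms shadowTerms : (a b c d e : ℤ) → List Term
codeTerms a b c d e =
    (+ 1) y^ 0
  ∷ (+ 388700 + + 2 * e) y^ 22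
  ∷ (+ 4791150 + + 128 * d - + 2 * e) y^ 24
  ∷ (+ 81082890 + + 8192 * c - + 896 * d - + 42 * e) y^ 26
  ∷ (+ 1200197180 + + 524288 * b - + 106496 * c + + 512 * d + + 42 * e) y^ 28
  ∷ (+ 14196225992 - + 33554432 * a - + 9961472 * b + + 532480 * c + + 10752 * d + + 420 * e) y^ 30
  ∷ []
shadowTerms a b c d e =
    a y^ 5
  ∷ (- (+ 30 * a) + b) y^ 9
  ∷ (+ 435 * a - + 28 * b - c) y^ 13
  ∷ (- (+ 4060 * a) + + 378 * b + + 26 * c + d) y^ 17
  ∷ (+ 27405 * a - + 3276 * b - + 325 * c - + 24 * d - e) y^ 21
  ∷ []

shadowWeights : List ℕ
shadowWeights = 5 ∷ 9 ∷ 13 ∷ 17 ∷ 21 ∷ []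

shadowWeights-unique : Unique shadowWeights
shadowWeights-unique = from-yes (unique? ℕₚ._≟_ shadowWeights)

-- The sum of `g` over `light`, with `k` for `K`. `A` and `B₅` to `B₂₁` stand for the numbers of
-- words with a 1 in the first coordinate, of weight 22 in C and of weights 5 to 21 in S.
lightSum : (k a b c d e A B₅ B₉ B₁₃ B₁₇ B₂₁ : ℤ) → ℤ
lightSum k a b c d e A B₅ B₉ B₁₃ B₁₇ B₂₁ =
    k * + 95680
  + ((k * 0ℤ * (+ 388700 + + 2 * e - A) + k * + 1 * A)
  + ((k * - (+ 4600) * (a - B₅) + k * - (+ 29900) * B₅)
  + ((k * - (+ 552) * (- (+ 30 * a) + b - B₉) + k * - (+ 4600) * B₉)
  + ((k * - (+ 46) * (+ 435 * a - + 28 * b - c - B₁₃) + k * - (+ 552) * B₁₃)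
  + ((k * - (+ 2) * (- (+ 4060 * a) + + 378 * b + + 26 * c + d - B₁₇) + k * - (+ 46) * B₁₇)
  + ((k * 0ℤ * (+ 27405 * a - + 3276 * b - + 325 * c - + 24 * d - e - B₂₁) + k * - (+ 2) * B₂₁)
  + 0ℤ))))))

-- The odd coefficient of `e` stems from the 388700 + 2e complements on the first side. In
-- `lightSum`, written out here for the ring solver, the class sizes involving `e` are multiplied by
-- the table entry 0, and after division by `k` the other coefficients of a, ..., d and the B's are
-- even.
heavySum-lightSum : ∀ p k a b c d e A B₅ B₉ B₁₃ B₁₇ B₂₁ →
  + 4 * p * k * (e - (A + + 35 * a - + 10 * b - + 3 * c - d - + 65780
    - + 12650 * B₅ - + 2024 * B₉ - + 253 * B₁₃ - + 22 * B₁₇ - B₂₁) * + 2) ≡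
    + 2 * (+ 2 * (p * k) * + 32890) + - (+ 2 * - (p * k)) * (+ 388700 + + 2 * e - + 2 * A)
  - + 4 * p *
  ( k * + 95680
  + ((k * 0ℤ * (+ 388700 + + 2 * e - A) + k * + 1 * A)
  + ((k * - (+ 4600) * (a - B₅) + k * - (+ 29900) * B₅)
  + ((k * - (+ 552) * (- (+ 30 * a) + b - B₉) + k * - (+ 4600) * B₉)
  + ((k * - (+ 46) * (+ 435 * a - + 28 * b - c - B₁₃) + k * - (+ 552) * B₁₃)
  + ((k * - (+ 2) * (- (+ 4060 * a) + + 378 * b + + 26 * c + d - B₁₇) + k * - (+ 46) * B₁₇)
  + ((k * 0ℤ * (+ 27405 * a - + 3276 * b - + 325 * c - + 24 * d - e - B₂₁) + k * - (+ 2) * B₂₁)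
  + 0ℤ)))))))
heavySum-lightSum = ℤ-Ring.solve-∀

-- Poisson summation for the code of length 130

module _ (C : Code (suc 129)) {vs : Vec (Word (suc 129)) 65} (basis : IsBasis C vs)
         (min-weight : ∀ v → Codeword C v → v ≢ 𝟎 → 22 ≤ wt v)
         (self-dual : SelfDual C) (singly-even : SinglyEven C)
         {W-C W-S : ℕ → ℕ}
         (enum-C : IsWeightEnumerator (Codeword C) W-C)
         (enum-S : IsWeightEnumerator (Shadow C) W-S)
         {a b c d e : ℤ}
         (W-C≐ : W-C ≐ codeTerms a b c d e +O[y^ 31 ])
         (W-S≐ : W-S ≐ shadowTerms a b c d e +O[y^ 22 ]) where

  open SinglyEvenSelfDual C basis self-dual singly-even
  private
    module 𝒞 = WeightClasses enum-C
    module 𝒮 = WeightClasses enum-S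

  g : Word (suc 129) → ℤ
  g = value (T₀ , T₁)

  -- The lists have 21 and 22 entries, and a leading 1 adds to the tail weight, so the support ends
  -- at weight 22.
  g-vanishes : ∀ u → 23 ≤ wt u → g u ≡ 0ℤ
  g-vanishes (0ℙ ∷ u) 23≤wt         = at-beyond T₀
    (subst (_≤ wt u) (sym length-T₀) (ℕₚ.≤-trans (ℕₚ.m≤n+m 21 2) 23≤wt))
  g-vanishes (1ℙ ∷ u) (ℕ.s≤s 22≤wt) = at-beyond T₁ (subst (_≤ wt u) (sym length-T₁) 22≤wt)

  f : Word (suc 129) → ℤ
  f c = 2×doublyEven c * (Q (eigenvalue c) * sgn (Vec.head c))

  -- `heavy` holds the words of C on which `f` may be nonzero, `light` the words of C and S on which
  -- `g` may be.
  heavy light : List (Word (suc 129))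
  heavy = 𝟎 ∷ map (𝟏 ⊕_) (𝒞.ofWeight 22)
  light = 𝟎 ∷ 𝒞.ofWeight 22 ++ 𝒮.ofWeights shadowWeights

  f-odd : ∀ {c} → halfParity c ≡ 1ℙ → f c ≡ 0ℤ
  f-odd {c} half≡1 = cong (λ p → (1ℤ + sgn p) * (Q (eigenvalue c) * sgn (Vec.head c))) half≡1

  f-root : ∀ {c} → eigenvalue c ∈ roots → f c ≡ 0ℤ
  f-root {c} e∈ = trans
    (cong (λ p → 2×doublyEven c * (p * sgn (Vec.head c))) (trans (Q≡ (eigenvalue c)) (∏-root e∈)))
    (ℤₚ.*-zeroʳ (2×doublyEven c))

  -- Otherwise `c` would be the all-one word, whose weight 130 is not divisible by 4.
  complement≢𝟎 : ∀ {c} → halfParity c ≡ 0ℙ → 𝟏 ⊕ c ≢ 𝟎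
  complement≢𝟎 {c} half≡0 eq = contradiction (trans (sym half≡0) (cong (λ m → parity ⌊ m /2⌋) wt-c)) λ ()
    where
    wt-c : wt c ≡ 130
    wt-c = trans (cong (ℕ._+ wt c) (sym (trans (cong wt eq) (wt-𝟎 130)))) (wt-complement c)

  -- The weight is 4(6 + i). The minimum weight bounds it below by 24; applied to the complement,
  -- whose weight is also not 22, it bounds it above by 107.
  eigenvalue∈roots : ∀ {c} → Codeword C c → halfParity c ≡ 0ℙ → c ∉ heavy → eigenvalue c ∈ roots
  eigenvalue∈roots {c} c∈ half≡0 c∉ = subst (_∈ roots) (sym eigenvalue≡) (∈-applyUpTo⁺ root i<21)
    where
    c≢𝟎 : c ≢ 𝟎
    c≢𝟎 = c∉ ∘ here
    co-wt≢22 : wt (𝟏 ⊕ c) ≢ 22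
    co-wt≢22 eq = c∉ (there (subst (_∈ map (𝟏 ⊕_) (𝒞.ofWeight 22)) (⊕-cancel 𝟏 c)
      (∈-map⁺ (𝟏 ⊕_) (𝒞.∈-ofWeight⁺ (Code.⊕-closed C 𝟏∈ c∈) eq))))
    22<co-wt : 22 < wt (𝟏 ⊕ c)
    22<co-wt = ℕₚ.≤∧≢⇒<
      (min-weight (𝟏 ⊕ c) (Code.⊕-closed C 𝟏∈ c∈) (complement≢𝟎 {c} half≡0)) (co-wt≢22 ∘ sym)
    j i : ℕ
    j = ⌊ ⌊ wt c /2⌋ /2⌋
    i = j ℕ.∸ 6
    wt≡j*4 : wt c ≡ j ℕ.* 4
    wt≡j*4 = even-halves⇒4* (wt c) (even c∈) half≡0
    -- A multiple of 4 below 24 is at most 20, which the minimum weight 22 forbids.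
    6≤j : 6 ≤ j
    6≤j = ℕₚ.≮⇒≥ λ j<6 → from-no (22 ℕₚ.≤? 20) (ℕₚ.≤-trans (min-weight c c∈ c≢𝟎)
      (ℕₚ.≤-trans (ℕₚ.≤-reflexive wt≡j*4) (ℕₚ.*-monoˡ-≤ 4 (ℕₚ.≤-pred j<6))))
    j≡6+i : j ≡ 6 ℕ.+ i
    j≡6+i = sym (ℕₚ.m+[n∸m]≡n 6≤j)
    wt≡ : wt c ≡ (6 ℕ.+ i) ℕ.* 4
    wt≡ = trans wt≡j*4 (cong (ℕ._* 4) j≡6+i)
    -- If i were at least 21, `c` would have weight at least 108 and its complement at least 23,
    -- more than 130 in total.
    i<21 : i < 21
    i<21 = ℕₚ.≰⇒> λ 21≤i → from-no (131 ℕₚ.≤? 130) (subst (131 ≤_) (wt-complement c)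
      (ℕₚ.+-mono-≤ 22<co-wt (subst (108 ≤_) (sym wt≡) (ℕₚ.*-monoˡ-≤ 4 {27} {6 ℕ.+ i} (ℕₚ.+-monoʳ-≤ 6 21≤i)))))
    eigenvalue≡ : eigenvalue c ≡ root i
    eigenvalue≡ = begin
      eigenvalue c                             ≡⟨ eigenvalue-wt c ⟩
      + 130 - + 2 * + wt c                     ≡⟨ cong (λ w → + 130 - + 2 * + w) wt≡ ⟩
      + 130 - + 2 * + ((6 ℕ.+ i) ℕ.* 4)        ≡⟨ cong (λ w → + 130 - + 2 * w) (ℤₚ.pos-* (6 ℕ.+ i) 4) ⟩
      + 130 - + 2 * ((+ 6 + + i) * + 4)        ≡⟨ simplify (+ i) ⟩
      root i                                   ∎
      where
      simplify : ∀ i → + 130 - + 2 * ((+ 6 + i) * + 4) ≡ + 82 - + 8 * i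
      simplify = ℤ-Ring.solve-∀

  f-vanishes : ∀ {c} → Codeword C c → c ∉ heavy → f c ≡ 0ℤ
  f-vanishes {c} c∈ c∉ = go (halfParity c) refl
    where
    go : ∀ p → halfParity c ≡ p → f c ≡ 0ℤ
    go 0ℙ half≡0 = f-root {c} (eigenvalue∈roots c∈ half≡0 c∉)
    go 1ℙ half≡1 = f-odd {c} half≡1

  f-doublyEven : ∀ {c e} → halfParity c ≡ 0ℙ → eigenvalue c ≡ e →
                 f c ≡ + 2 * (Q e * sgn (Vec.head c))
  f-doublyEven {c} half≡0 eigenvalue≡ =
    cong₂ (λ p x → (1ℤ + sgn p) * (Q x * sgn (Vec.head c))) half≡0 eigenvalue≡

  f-𝟎 : f 𝟎 ≡ + 2 * Q (+ 130)
  f-𝟎 = trans (f-doublyEven {𝟎} (cong (λ m → parity ⌊ m /2⌋) (wt-𝟎 130))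
                (trans (eigenvalue-wt (𝟎 {130})) (cong (λ w → + 130 - + 2 * + w) (wt-𝟎 130))))
              (cong (_*_ (+ 2)) (ℤₚ.*-identityʳ (Q (+ 130))))

  sgn-head-complement : ∀ {n} (v : Word (suc n)) → sgn (Vec.head (𝟏 ⊕ v)) ≡ -1ℤ * sgn (Vec.head v)
  sgn-head-complement (x ∷ v) = sgn-+ 1ℙ x

  wt-complement-22 : ∀ {v} → v ∈ 𝒞.ofWeight 22 → wt (𝟏 ⊕ v) ≡ 108
  wt-complement-22 {v} v∈ = ℕₚ.+-cancelʳ-≡ 22 _ _
    (trans (cong (wt (𝟏 ⊕ v) ℕ.+_) (sym (proj₂ (𝒞.∈-ofWeight⁻ v∈)))) (wt-complement v))

  -- The complement has weight 108, divisible by 4, and eigenvalue 130 - 216 = -86; complementing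
  -- flips the first coordinate, hence the minus sign.
  f-complement : ∀ {v} → v ∈ 𝒞.ofWeight 22 → f (𝟏 ⊕ v) ≡ - (+ 2 * Q (- (+ 86))) * sgn (Vec.head v)
  f-complement {v} v∈ = begin
    f (𝟏 ⊕ v)
      ≡⟨ f-doublyEven {𝟏 ⊕ v} (cong (λ m → parity ⌊ m /2⌋) wt≡108)
           (trans (eigenvalue-wt (𝟏 ⊕ v)) (cong (λ w → + 130 - + 2 * + w) wt≡108)) ⟩
    + 2 * (Q (- (+ 86)) * sgn (Vec.head (𝟏 ⊕ v)))
      ≡⟨ cong (λ x → + 2 * (Q (- (+ 86)) * x)) (sgn-head-complement v) ⟩
    + 2 * (Q (- (+ 86)) * (-1ℤ * sgn (Vec.head v)))
      ≡⟨ regroup (Q (- (+ 86))) (sgn (Vec.head v)) ⟩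
    - (+ 2 * Q (- (+ 86))) * sgn (Vec.head v) ∎
    where
    wt≡108 = wt-complement-22 v∈
    regroup : ∀ q s → + 2 * (q * (-1ℤ * s)) ≡ - (+ 2 * q) * s
    regroup = ℤ-Ring.solve-∀

  A₂₂ A₂₂′ : ℤ
  A₂₂  = + length (𝒞.ofWeight 22)
  A₂₂′ = headOnes (𝒞.ofWeight 22)

  ∑-heavy : ∑ heavy f ≡ + 2 * Q (+ 130) + - (+ 2 * Q (- (+ 86))) * (A₂₂ - + 2 * A₂₂′)
  ∑-heavy = cong₂ _+_ f-𝟎 (begin
    ∑ (map (𝟏 ⊕_) (𝒞.ofWeight 22)) f
      ≡⟨ ∑-map (𝟏 ⊕_) (𝒞.ofWeight 22) f ⟩
    ∑[ v ∈ 𝒞.ofWeight 22 ] f (𝟏 ⊕ v)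
      ≡⟨ ∑-cong (𝒞.ofWeight 22) f-complement ⟩
    ∑[ v ∈ 𝒞.ofWeight 22 ] q * sgn (Vec.head v)
      ≡⟨ ∑-distribˡ-* (𝒞.ofWeight 22) q _ ⟩
    q * (∑[ v ∈ 𝒞.ofWeight 22 ] sgn (Vec.head v))
      ≡⟨ cong (q *_) (∑-sgn-head (𝒞.ofWeight 22)) ⟩
    q * (A₂₂ - + 2 * A₂₂′) ∎)
    where
    q = - (+ 2 * Q (- (+ 86)))

  heavy-unique : Unique heavy
  heavy-unique = Allₚ.¬Any⇒All¬ _ 𝟎∉ ∷ Unique.map⁺ 𝟏⊕-injective (𝒞.ofWeight-unique 22)
    where
    𝟏⊕-injective : ∀ {u v : Word (suc 129)} → 𝟏 ⊕ u ≡ 𝟏 ⊕ v → u ≡ v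
    𝟏⊕-injective {u} {v} eq = trans (sym (⊕-cancel 𝟏 u)) (trans (cong (𝟏 ⊕_) eq) (⊕-cancel 𝟏 v))
    𝟎∉ : 𝟎 ∉ map (𝟏 ⊕_) (𝒞.ofWeight 22)
    𝟎∉ 𝟎∈ =
      let v , v∈ , eq = ∈-map⁻ (𝟏 ⊕_) 𝟎∈ in
      contradiction (trans (sym (wt-complement-22 v∈)) (trans (cong wt (sym eq)) (wt-𝟎 130))) λ ()

  light-unique : Unique light
  light-unique = Allₚ.¬Any⇒All¬ _ 𝟎∉ ∷
    Unique.++⁺ (𝒞.ofWeight-unique 22) (𝒮.ofWeights-unique shadowWeights-unique) disjoint
    where
    𝟎∉ : 𝟎 ∉ 𝒞.ofWeight 22 ++ 𝒮.ofWeights shadowWeights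
    𝟎∉ 𝟎∈ with ∈-++⁻ (𝒞.ofWeight 22) 𝟎∈
    ... | inj₁ 𝟎∈22 = contradiction (trans (sym (wt-𝟎 130)) (proj₂ (𝒞.∈-ofWeight⁻ 𝟎∈22))) λ ()
    ... | inj₂ 𝟎∈S  = proj₂ (proj₁ (𝒮.∈-ofWeights⁻ shadowWeights 𝟎∈S)) (Code.𝟎-closed C)
    disjoint : Disjoint (𝒞.ofWeight 22) (𝒮.ofWeights shadowWeights)
    disjoint (v∈C , v∈S) =
      proj₂ (proj₁ (𝒮.∈-ofWeights⁻ shadowWeights v∈S)) (proj₁ (𝒞.∈-ofWeight⁻ v∈C))

  codeword∈light : ∀ {u} → Codeword C u → wt u < 23 → u ∈ light
  codeword∈light {u} u∈ wt<23 = go (u ≟ʷ 𝟎)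
    where
    go : Dec (u ≡ 𝟎) → u ∈ light
    go (yes u≡𝟎) = here u≡𝟎
    go (no u≢𝟎)  = there (∈-++⁺ˡ (𝒞.∈-ofWeight⁺ u∈
      (ℕₚ.≤-antisym (ℕₚ.≤-pred wt<23) (min-weight u u∈ u≢𝟎))))

  -- Shadow weights have the parity of 65, which excludes 22; below 22 the expansion of the
  -- enumerator leaves only `shadowWeights`.
  shadow∈light : ∀ {u} → Shadow C u → wt u < 23 → u ∈ light
  shadow∈light {u} u∈S wt<23 = there (∈-++⁺ʳ (𝒞.ofWeight 22)
    (𝒮.∈-ofWeights⁺ u∈S (𝒮.wt∈exponents {shadowTerms a b c d e} W-S≐ u∈S
      (ℕₚ.≤∧≢⇒< (ℕₚ.≤-pred wt<23) wt≢22))))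
    where
    wt≢22 : wt u ≢ 22
    wt≢22 eq = contradiction (trans (sym (shadow-wt u∈S)) (cong parity eq)) λ ()

  light⊆C∪S : ∀ {u} → u ∈ light → Codeword C u ⊎ Shadow C u
  light⊆C∪S (here u≡𝟎) = inj₁ (subst (Codeword C) (sym u≡𝟎) (Code.𝟎-closed C))
  light⊆C∪S (there u∈) = Sum.map (proj₁ ∘ 𝒞.∈-ofWeight⁻) (proj₁ ∘ 𝒮.∈-ofWeights⁻ shadowWeights)
    (∈-++⁻ (𝒞.ofWeight 22) u∈)

  g-support : ∀ {u} → Codeword C u ⊎ Shadow C u → u ∉ light → g u ≡ 0ℤ
  g-support {u} u∈C∪S u∉ = g-vanishes u (ℕₚ.≮⇒≥ λ wt<23 → u∉ (low u∈C∪S wt<23))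
    where
    low : Codeword C u ⊎ Shadow C u → wt u < 23 → u ∈ light
    low (inj₁ u∈C) = codeword∈light u∈C
    low (inj₂ u∈S) = shadow∈light u∈S

  𝓕-g : ∀ c → 𝓕 g c ≡ Q (eigenvalue c) * sgn (Vec.head c)
  𝓕-g = 𝓕-value-table {129} {roots} {T₀ , T₁} {Q} table≡ Q≡

  f≡ : ∀ c → 2×doublyEven c * 𝓕 g c ≡ f c
  f≡ c = cong (2×doublyEven c *_) (𝓕-g c)

  heavy⊆C : ∀ {v} → v ∈ heavy → Codeword C v
  heavy⊆C (here v≡𝟎) = subst (Codeword C) (sym v≡𝟎) (Code.𝟎-closed C)
  heavy⊆C (there v∈) =
    let u , u∈ , eq = ∈-map⁻ (𝟏 ⊕_) v∈ in
    subst (Codeword C) (sym eq) (Code.⊕-closed C 𝟏∈ (proj₁ (𝒞.∈-ofWeight⁻ u∈)))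

  heavy≡light : ∑ heavy f ≡ + 4 * P * ∑ light g
  heavy≡light = trans
    (poisson-support g f f≡ heavy-unique light-unique heavy⊆C f-vanishes light⊆C∪S g-support)
    (cong (_* ∑ light g) 2^65≡4*P)

  -- `half-e` is the integer whose double is subtracted from `e` in `heavySum-lightSum`.
  B₅′ B₉′ B₁₃′ B₁₇′ B₂₁′ half-e : ℤ
  B₅′  = headOnes (𝒮.ofWeight 5)
  B₉′  = headOnes (𝒮.ofWeight 9)
  B₁₃′ = headOnes (𝒮.ofWeight 13)
  B₁₇′ = headOnes (𝒮.ofWeight 17)
  B₂₁′ = headOnes (𝒮.ofWeight 21)
  half-e = A₂₂′ + + 35 * a - + 10 * b - + 3 * c - d - + 65780
         - + 12650 * B₅′ - + 2024 * B₉′ - + 253 * B₁₃′ - + 22 * B₁₇′ - B₂₁′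

  A₂₂≡ : A₂₂ ≡ + 388700 + + 2 * e
  A₂₂≡ = 𝒞.length≡coefficient {codeTerms a b c d e} W-C≐
    (from-yes (unique? ℕₚ._≟_ (0 ∷ 22 ∷ 24 ∷ 26 ∷ 28 ∷ 30 ∷ []))) (there (here refl)) (ℕₚ.m≤m+n 23 8)

  ∑-shadow : ∀ {i x y l} → at T₀ i ≡ x → at T₁ (pred i) ≡ y →
             (l , i) ∈ shadowTerms a b c d e → i < 22 →
             ∑ (𝒮.ofWeight i) g ≡ x * (l - headOnes (𝒮.ofWeight i)) + y * headOnes (𝒮.ofWeight i)
  ∑-shadow {i} x≡ y≡ l∈ i<22 = ∑-value-class T₀ T₁ i (𝒮.ofWeight i)
    (λ v∈ → proj₂ (𝒮.∈-ofWeight⁻ v∈)) x≡ y≡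
    (𝒮.length≡coefficient {shadowTerms a b c d e} W-S≐ shadowWeights-unique l∈ i<22)

  ∑-light : ∑ light g ≡ lightSum K a b c d e A₂₂′ B₅′ B₉′ B₁₃′ B₁₇′ B₂₁′
  ∑-light = cong₂ _+_ (trans (cong (at T₀) (wt-𝟎 129)) at-T₀-0)
    (trans (∑-++ (𝒞.ofWeight 22) (𝒮.ofWeights shadowWeights) g) (cong₂ _+_
      (∑-value-class T₀ T₁ 22 (𝒞.ofWeight 22) (λ v∈ → proj₂ (𝒞.∈-ofWeight⁻ v∈)) at-T₀-22 at-T₁-21 A₂₂≡)
      (trans (∑-concatMap 𝒮.ofWeight shadowWeights g)
        (cong₂ _+_ (∑-shadow at-T₀-5 at-T₁-4 (here refl) (ℕₚ.m≤m+n 6 16))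
        (cong₂ _+_ (∑-shadow at-T₀-9 at-T₁-8 (there (here refl)) (ℕₚ.m≤m+n 10 12))
        (cong₂ _+_ (∑-shadow at-T₀-13 at-T₁-12 (there (there (here refl))) (ℕₚ.m≤m+n 14 8))
        (cong₂ _+_ (∑-shadow at-T₀-17 at-T₁-16 (there (there (there (here refl)))) (ℕₚ.m≤m+n 18 4))
        (cong (_+ 0ℤ) (∑-shadow at-T₀-21 at-T₁-20 (there (there (there (there (here refl))))) (ℕₚ.m≤m+n 22 0))))))))))

  heavySum : ℤ
  heavySum = + 2 * (+ 2 * (P * K) * + 32890) + - (+ 2 * - (P * K)) * (+ 388700 + + 2 * e - + 2 * A₂₂′)

  ∑-heavy≡heavySum : ∑ heavy f ≡ heavySum
  ∑-heavy≡heavySum = trans ∑-heavy (cong₂ _+_ (cong (+ 2 *_) Q-130)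
    (cong₂ (λ q l → - (+ 2 * q) * (l - + 2 * A₂₂′)) Q--86 A₂₂≡))

  heavySum≡lightSum : heavySum ≡ + 4 * P * lightSum K a b c d e A₂₂′ B₅′ B₉′ B₁₃′ B₁₇′ B₂₁′
  heavySum≡lightSum = trans (sym ∑-heavy≡heavySum) (trans heavy≡light (cong (_*_ (+ 4 * P)) ∑-light))

  -- Poisson summation makes the difference of the two sides vanish after multiplication by
  -- `4 * P * K`, and this factor is nonzero.
  e≡2*half-e : e ≡ half-e * + 2
  e≡2*half-e = ℤₚ.i-j≡0⇒i≡j e (half-e * + 2) (cancel (ℤₚ.i*j≡0⇒i≡0∨j≡0 (+ 4 * P * K) product≡0))
    where
    product≡0 : + 4 * P * K * (e - half-e * + 2) ≡ 0ℤ
    product≡0 = trans (heavySum-lightSum P K a b c d e A₂₂′ B₅′ B₉′ B₁₃′ B₁₇′ B₂₁′)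
                      (ℤₚ.i≡j⇒i-j≡0 {heavySum} heavySum≡lightSum)
    cancel : + 4 * P * K ≡ 0ℤ ⊎ e - half-e * + 2 ≡ 0ℤ → e - half-e * + 2 ≡ 0ℤ
    cancel (inj₁ 4PK≡0) = contradiction 4PK≡0 4*P*K≢0
    cancel (inj₂ eq)    = eq

  2∣e : + 2 ∣ e
  2∣e = ∣⇒∣ᵤ (divides half-e e≡2*half-e)

proposition4 : (C : Code 130) →
    Is[ 130 , 65 , 22 ] C →
    SelfDual C →
    SinglyEven C →
    MinimumWeightAtLeast (Shadow C) 5 →
    (W-C W-S : ℕ → ℕ) →
    IsWeightEnumerator (Codeword C) W-C →
    IsWeightEnumerator (Shadow C) W-S →
    (a b c d e : ℤ) →
    W-C ≐ (+ 1) y^ 0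
    ∷ (+ 388700 + + 2 * e) y^ 22
    ∷ (+ 4791150 + + 128 * d - + 2 * e) y^ 24
    ∷ (+ 81082890 + + 8192 * c - + 896 * d - + 42 * e) y^ 26
    ∷ (+ 1200197180 + + 524288 * b - + 106496 * c + + 512 * d + + 42 * e) y^ 28
    ∷ (+ 14196225992 - + 33554432 * a - + 9961472 * b + + 532480 * c + + 10752 * d + + 420 * e) y^ 30
    ∷ [] +O[y^ 31 ] →
    W-S ≐ a y^ 5
    ∷ (- (+ 30 * a) + b) y^ 9
    ∷ (+ 435 * a - + 28 * b - c) y^ 13
    ∷ (- (+ 4060 * a) + + 378 * b + + 26 * c + d) y^ 17
    ∷ (+ 27405 * a - + 3276 * b - + 325 * c - + 24 * d - e) y^ 21
    ∷ [] +O[y^ 22 ] →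
    + 2 ∣ e
proposition4 C ((_ , basis) , _ , min-weight) self-dual singly-even _ _ _ enum-C enum-S a b c d e W-C≐ W-S≐ =
  2∣e C basis min-weight self-dual singly-even enum-C enum-S W-C≐ W-S≐
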